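{- Let $\Gamma$ be a connected signed graph with $n$ vertices and $m$ edges, with Laplacian eigenvalues $\mu_1\ge\cdots\ge\mu_n\ge 0$. Let $p$ be a positive integer and $k\in\{p,p-1\}$. Then the adjacency spectrum of $S_p^k(\Gamma)$, as a multiset, is: if $\Gamma$ is balanced: $0$ with multiplicity $(p-1)n+(k+1)m+2$, together with $\pm\sqrt{(p+1)(k+1)\mu_i}$ for $i=1,\dots,n-1$; if $\Gamma$ is unbalanced: $0$ with multiplicity $(p-1)n+(k+1)m$, together with $\pm\sqrt{(p+1)(k+1)\mu_i}$ for $i=1,\dots,n$.
   Context: A signed graph $\Gamma=(G,\sigma)$ is a simple graph $G$ with a sign function $\sigma:E(G)\to\{1,-1\}$; its adjacency matrix $A(\Gamma)$ has $(i,j)$ entry $\sigma(v_iv_j)$ if $v_iv_j\in E(G)$ and $0$ otherwise, and its Laplacian matrix is $L(\Gamma)=D(G)-A(\Gamma)$ with $D(G)$ the diagonal degree matrix. $\Gamma$ is balanced if every cycle has an even number of negative edges, unbalanced otherwise. Orientation: for $\Gamma$ with vertices $v_1,\dots,v_n$ and edges $e_1,\dots,e_m$, fix $\vartheta(v,e)\in\{1,-1\}$ for each vertex $v$ incident with edge $e$, such that for every edge $e=vw$, $\vartheta(v,e)\vartheta(w,e)=-\sigma(e)$. The signed graph $S_p^k(\Gamma)$ (for integers $p\ge1$, $k\ge 0$): its vertex set is $\{v_i^{(s)}:1\le i\le n,\ 0\le s\le p\}\cup\{e_j^{(t)}:1\le j\le m,\ 0\le t\le k\}$; its edges are exactly the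 pairs $v_i^{(s)}e_j^{(t)}$ with $v_i$ an end of $e_j$ in $G$, of sign $\vartheta(v_i,e_j)$. Equivalently, starting from the signed subdivision graph $S(\Gamma)$, one adds $p$ copies of each original vertex $v_i$ joined to the neighbours of $v_i$ with the same signs, and then $k$ copies of each edge-vertex $e_j$ joined to all (old and new) neighbours of $e_j$ with the same signs. It has $(p+1)n+(k+1)m$ vertices and $2(p+1)(k+1)m$ edges. -}

module Defs where

open import Level using (Level; 0ℓ; _⊔_) renaming (suc to lsuc)
open import Algebra.Bundles using (CommutativeRing; Semiring)
open import Algebra.Apartness.Bundles using (HeytingField)
import Algebra.Definitions.RawSemiring as RawSemiringDefs
open import Data.Bool.Base using (if_then_else_)
open import Data.Empty using (⊥)
open import Data.Fin.Base as Fin using (Fin; zero; suc; toℕ; punchIn)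
import Data.Fin.Properties as Fin
open import Data.List.Base as List using (List; []; _∷_; length)
open import Data.List.Relation.Unary.Unique.Propositional using (Unique)
open import Data.Nat.Base as ℕ using (ℕ; zero; suc)
open import Data.Nat.Divisibility using (_∣_)
open import Data.Product.Base using (_×_; _,_; proj₁; proj₂; ∃₂)
open import Data.Sign.Base as Sign using (Sign)
open import Data.Sum.Base using (_⊎_; inj₁; inj₂)
open import Data.Sum.Function.Propositional using (_⊎-↔_)
open import Function.Bundles using (_↔_; Inverse)
open import Function.Properties.Inverse using (↔-trans)
open import Relation.Binary.Core using (Rel)
open import Relation.Binary.Construct.Closure.ReflexiveTransitive
  using (Star; ε; _◅_)
open import Relation.Binary.Definitions using (Decidable; Symmetric)
open import Relation.Binary.PropositionalEquality
  using (_≡_; refl)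
open import Relation.Binary.Structures using (IsStrictPartialOrder)
open import Relation.Nullary using (¬_; Dec; yes; no; does)
open import Relation.Nullary.Decidable using (True; _⊎-dec_)

------------------------------------------------------------------------
-- Scalars

-- An ordered field in which non-negative elements have square roots, in
-- the constructive sense (apartness is "smaller or larger", and x ≤ y is
-- ¬ y < x).  The intended model is ℝ, which the standard library lacks;
-- the real algebraic numbers are another.  √ is total, and only its
-- values at non-negative arguments are specified.
record EuclideanField c ℓ₁ ℓ₂ : Set (lsuc (c ⊔ ℓ₁ ⊔ ℓ₂)) where
  infix 4 _<_ _≤_
  field
    heytingField : HeytingField c ℓ₁ ℓ₂

  open HeytingField heytingField public

  field
    _<_                  : Rel Carrier ℓ₂
    isStrictPartialOrder : IsStrictPartialOrder _≈_ _<_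
    #⇒<⊎>                : ∀ {x y} → x # y → x < y ⊎ y < x
    <⇒#                  : ∀ {x y} → x < y → x # y
    +-monoˡ-<            : ∀ z {x y} → x < y → (x + z) < (y + z)
    *-pos                : ∀ {x y} → 0# < x → 0# < y → 0# < (x * y)

  _≤_ : Rel Carrier ℓ₂
  x ≤ y = ¬ (y < x)

  field
    √        : Carrier → Carrier
    √-cong   : ∀ {x y} → x ≈ y → √ x ≈ √ y
    √-nonneg : ∀ {x} → 0# ≤ x → 0# ≤ √ x
    √-square : ∀ {x} → 0# ≤ x → (√ x * √ x) ≈ x

  commutativeRing : CommutativeRing c ℓ₁
  commutativeRing = record { isCommutativeRing = isCommutativeRing }

  open Semiring (CommutativeRing.semiring commutativeRing) public
    using (rawSemiring)

------------------------------------------------------------------------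
-- Signed graphs

-- σ u v is meaningful only when u ~ v.
record SignedGraph (V : Set) : Set₁ where
  infix 4 _~_ _~?_
  field
    _~_      : Rel V 0ℓ
    _~?_     : Decidable _~_
    ~-sym    : Symmetric _~_
    ~-irrefl : ∀ {v} → ¬ (v ~ v)
    σ        : V → V → Sign
    σ-sym    : ∀ {u v} → u ~ v → σ u v ≡ σ v u

negative : Sign → ℕ
negative Sign.- = 1
negative Sign.+ = 0

module _ {V : Set} (Γ : SignedGraph V) where
  open SignedGraph Γ

  Connected : Set
  Connected = V × (∀ u v → Star _~_ u v)

  -- The starting vertex of each step; the final vertex is left out, so
  -- that a closed walk does not list its base point twice.
  starts : ∀ {u v} → Star _~_ u v → List V
  starts ε               = []
  starts (_◅_ {u} _ w) = u ∷ starts w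

  negativeEdges : ∀ {u v} → Star _~_ u v → ℕ
  negativeEdges ε                   = 0
  negativeEdges (_◅_ {u} {v} _ w) = negative (σ u v) ℕ.+ negativeEdges w

  IsCycle : ∀ {v} → Star _~_ v v → Set
  IsCycle w = 3 ℕ.≤ length (starts w) × Unique (starts w)

  Balanced : Set
  Balanced = ∀ {v} (w : Star _~_ v v) → IsCycle w → 2 ∣ negativeEdges w

-- Each unordered pair of adjacent vertices is represented once, by its
-- increasing ordering.
Edge : ∀ {n} → SignedGraph (Fin n) → Set
Edge Γ = ∃₂ λ i j → i Fin.< j × True (i ~? j)
  where open SignedGraph Γ

------------------------------------------------------------------------
-- Orientations and the graph S_p^k(Γ)

-- A bijection e lists the edges of Γ as e₁, …, eₘ.
module _ {n m} (Γ : SignedGraph (Fin n)) (e : Fin m ↔ Edge Γ) where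
  open SignedGraph Γ

  end₁ end₂ : Fin m → Fin n
  end₁ j = proj₁ (Inverse.to e j)
  end₂ j = proj₁ (proj₂ (Inverse.to e j))

  Incident : Fin n → Fin m → Set
  Incident i j = i ≡ end₁ j ⊎ i ≡ end₂ j

  incident? : ∀ i j → Dec (Incident i j)
  incident? i j = (i Fin.≟ end₁ j) ⊎-dec (i Fin.≟ end₂ j)

  -- ϑ i j is meaningful only when vertex i is incident with edge j.
  IsOrientation : (Fin n → Fin m → Sign) → Set
  IsOrientation ϑ = ∀ j →
    ϑ (end₁ j) j Sign.* ϑ (end₂ j) j ≡ Sign.opposite (σ (end₁ j) (end₂ j))

  -- inj₁ (i , s) is vᵢ⁽ˢ⁾ and inj₂ (j , t) is eⱼ⁽ᵗ⁾, with index 0 for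
  -- the vertices of the signed subdivision graph.
  SVertex : ℕ → ℕ → Set
  SVertex p k = (Fin n × Fin (suc p)) ⊎ (Fin m × Fin (suc k))

  SGraph : (Fin n → Fin m → Sign) → ∀ p k → SignedGraph (SVertex p k)
  SGraph ϑ p k = record
    { _~_      = Adj
    ; _~?_     = adj?
    ; ~-sym    = λ {x} {y} → adj-sym x y
    ; ~-irrefl = λ {x} → adj-irrefl x
    ; σ        = sign
    ; σ-sym    = λ {x} {y} → sign-sym x y
    }
    where
    Adj : Rel (SVertex p k) 0ℓ
    Adj (inj₁ (i , _)) (inj₂ (j , _)) = Incident i j
    Adj (inj₂ (j , _)) (inj₁ (i , _)) = Incident i j
    Adj (inj₁ _)       (inj₁ _)       = ⊥
    Adj (inj₂ _)       (inj₂ _)       = ⊥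

    adj? : Decidable Adj
    adj? (inj₁ (i , _)) (inj₂ (j , _)) = incident? i j
    adj? (inj₂ (j , _)) (inj₁ (i , _)) = incident? i j
    adj? (inj₁ _)       (inj₁ _)       = no λ ()
    adj? (inj₂ _)       (inj₂ _)       = no λ ()

    adj-sym : ∀ x y → Adj x y → Adj y x
    adj-sym (inj₁ _) (inj₂ _) a = a
    adj-sym (inj₂ _) (inj₁ _) a = a

    adj-irrefl : ∀ x → ¬ Adj x x
    adj-irrefl (inj₁ _) ()
    adj-irrefl (inj₂ _) ()

    -- The value between non-adjacent vertices is arbitrary.
    sign : SVertex p k → SVertex p k → Sign
    sign (inj₁ (i , _)) (inj₂ (j , _)) = ϑ i j
    sign (inj₂ (j , _)) (inj₁ (i , _)) = ϑ i j
    sign (inj₁ _)       (inj₁ _)       = Sign.+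
    sign (inj₂ _)       (inj₂ _)       = Sign.+

    sign-sym : ∀ x y → Adj x y → sign x y ≡ sign y x
    sign-sym (inj₁ _) (inj₂ _) _ = refl
    sign-sym (inj₂ _) (inj₁ _) _ = refl

  SVertices : ∀ p k → Fin (n ℕ.* suc p ℕ.+ m ℕ.* suc k) ↔ SVertex p k
  SVertices p k = ↔-trans Fin.+↔⊎ (Fin.*↔× ⊎-↔ Fin.*↔×)

------------------------------------------------------------------------
-- Matrices and spectra

module Spectral {c ℓ₁ ℓ₂} (F : EuclideanField c ℓ₁ ℓ₂) where
  open EuclideanField F hiding (zero)
  open RawSemiringDefs rawSemiring public
    using (_^_; sum) renaming (_×_ to infixr 8 _·_)

  Matrix : Set → Set c
  Matrix V = V → V → Carrier

  det : ∀ {N} → Matrix (Fin N) → Carrier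
  det {zero}  M = 1#
  det {suc N} M = sum λ j →
    ((- 1#) ^ toℕ j) * (M zero j * det (λ r s → M (suc r) (punchIn j s)))

  charMatrix : ∀ {N} → Matrix (Fin N) → Carrier → Matrix (Fin N)
  charMatrix M x i j = (if does (i Fin.≟ j) then x else 0#) - M i j

  charPoly : ∀ {N} → Matrix (Fin N) → Carrier → Carrier
  charPoly M x = det (charMatrix M x)

  -- The multiset of eigenvalues is the multiset of roots of the
  -- characteristic polynomial: det (x I − M) = ∏ (x − λ), λ running over
  -- the list.  An ordered field is infinite, so an identity between
  -- polynomials is the same as one between their values at every x.
  IsSpectrum : ∀ {N} → Matrix (Fin N) → List Carrier → Set (c ⊔ ℓ₁)
  IsSpectrum M λs =
    ∀ x → charPoly M x ≈ List.foldr _*_ 1# (List.map (λ y → x - y) λs)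

  reindex : ∀ {V N} → Fin N ↔ V → Matrix V → Matrix (Fin N)
  reindex f M i j = M (Inverse.to f i) (Inverse.to f j)

  signValue : Sign → Carrier
  signValue Sign.+ = 1#
  signValue Sign.- = - 1#

  adjacency : ∀ {V} → SignedGraph V → Matrix V
  adjacency Γ u v = if does (u ~? v) then signValue (σ u v) else 0#
    where open SignedGraph Γ

  degree : ∀ {n} → SignedGraph (Fin n) → Fin n → ℕ
  degree Γ v = length (List.filter (v ~?_) (List.allFin _))
    where open SignedGraph Γ

  laplacian : ∀ {n} → SignedGraph (Fin n) → Matrix (Fin n)
  laplacian Γ u v =
    (if does (u Fin.≟ v) then degree Γ u · 1# else 0#) - adjacency Γ u v

  -- The adjacency matrix of S_p^k(Γ), rows and columns ordered by
  -- SVertices.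
  adjacencyS : ∀ {n m} (Γ : SignedGraph (Fin n)) (e : Fin m ↔ Edge Γ) →
               (Fin n → Fin m → Sign) → ∀ p k →
               Matrix (Fin (n ℕ.* suc p ℕ.+ m ℕ.* suc k))
  adjacencyS Γ e ϑ p k =
    reindex (SVertices Γ e p k) (adjacency (SGraph Γ e ϑ p k))

  -- ± √ (a μ) for μ running over a list.
  ±√ : ℕ → List Carrier → List Carrier
  ±√ a = List.concatMap λ y → √ (a · y) ∷ - √ (a · y) ∷ []

{-# OPTIONS --safe #-}
-- With T = [ xI U ; V zI ] (U of size a × b), eliminating either off-diagonal block gives
--   zᵃ det T = zᵇ det (xz I − UV)   and   xᵇ det T = xᵃ det (xz I − VU).
-- The adjacency matrix of S_p^k(Γ) is [ 0 C ; Cᵀ 0 ], where C repeats every row of the incidence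
-- matrix B p + 1 times and every column k + 1 times, and B Bᵀ = L. Hence C Cᵀ is (k + 1) L with
-- rows and columns repeated p + 1 times, and using the identities once more relates its
-- characteristic polynomial to that of (p + 1)(k + 1) L. The powers of x so introduced cancel
-- when x is apart from 0; at x = 0 the adjacency matrix has two equal rows because p ≥ 1, and
-- tightness of the apartness covers every x. If Γ is balanced, a switching function is a null
-- vector of L, so the least Laplacian eigenvalue is 0.
module Submission where

open import Defs
open import Level using (_⊔_)
open import Algebra.Apartness.Bundles using (HeytingField)
import Algebra.Apartness.Properties.HeytingCommutativeRing as ApartnessProperties
open import Algebra.Bundles using (CommutativeRing)
import Algebra.Properties.CommutativeMonoid.Mult as MultProperties
import Algebra.Properties.CommutativeSemiring.Exp as ExpProperties
import Algebra.Properties.Ring as RingProperties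
import Algebra.Properties.Semiring.Mult as SemiringMultProperties
import Algebra.Properties.Semiring.Sum as SumProperties
import Algebra.Solver.Ring.NaturalCoefficients.Default as SemiringSolver
open import Data.Bool.Base using (if_then_else_; true; false)
open import Data.Bool.Properties using (T-irrelevant)
open import Data.Fin.Base as Fin
  using (Fin; zero; suc; toℕ; punchIn; _↑ˡ_; _↑ʳ_; splitAt; quotient; remQuot)
import Data.Fin.Properties as Fin
open import Data.List.Base as List
  using (List; []; _∷_; _++_; length; filter; replicate; tabulate; take)
open import Data.List.Membership.Propositional using (_∈_)
import Data.List.Properties as List
open import Data.List.Relation.Unary.All using (All; []; _∷_)
open import Data.List.Relation.Unary.All.Properties using (¬Any⇒All¬; tabulate⁺; take⁺)
open import Data.List.Relation.Unary.AllPairs using ([]; _∷_)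
open import Data.List.Relation.Unary.Any using (here; there)
open import Data.List.Relation.Unary.Unique.Propositional using (Unique)
open import Data.Nat.Base as ℕ using (ℕ; zero; suc; _∸_; z≤n; s≤s)
open import Data.Nat.Divisibility using (_∣_; divides)
import Data.Nat.Properties as ℕ
open import Data.Nat.Solver using (module +-*-Solver)
open import Data.Product.Base using (_×_; _,_; proj₁; proj₂; ∃; ∃₂)
open import Data.Sign.Base as Sign using (Sign)
import Data.Sign.Properties as Sign
open import Data.Sum.Base as Sum using (_⊎_; inj₁; inj₂)
open import Data.Vec.Functional
  using (Vector; tail) renaming (_∷_ to _∷ᵛ_; _++_ to _++ᵛ_)
open import Data.Vec.Functional.Properties using (lookup-++ˡ; lookup-++ʳ)
open import Function.Base using (_∘_)
open import Function.Bundles using (_↔_; Inverse; mk⇔)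
open import Relation.Binary.Construct.Closure.ReflexiveTransitive using (Star; ε; _◅_; _◅◅_)
open import Relation.Binary.Definitions using (DecidableEquality; tri<; tri≈; tri>)
open import Relation.Binary.PropositionalEquality as ≡ using (_≡_; _≢_; _≗_)
import Relation.Binary.Reasoning.Setoid as SetoidReasoning
open import Relation.Binary.Structures using (IsStrictPartialOrder)
open import Relation.Nullary using (¬_; Dec; yes; no; does; contradiction)
open import Relation.Nullary.Decidable
  using (toWitness; fromWitness; _×-dec_; _⊎-dec_; dec-true; dec-false; does-⇔)
open import Relation.Unary using (Pred; Decidable)

-- Equality of scalars is not decidable, so neither "x is 0 or it is not" nor "a zero product has a
-- zero factor" is available as a case split. Every such step instead refutes an apartness and
-- concludes by tightness. The cancellation argument then leaves one obligation: the claimed product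
-- must vanish at x = 0. Unbalanced graphs meet it because they have an edge, which makes the
-- exponent of x positive. In the balanced case that exponent can be 0, and the vanishing comes from
-- the least Laplacian eigenvalue: its pair of square roots contributes x², which is also the origin
-- of the extra multiplicity 2. Both elimination identities are matrix products with a triangular
-- factor, hence rest on multiplicativity of `det`. This is proved for every alternating function of
-- `n` rows of arbitrary width, not for `det` alone, because fixing the top row of a square matrix
-- leaves rows that are too wide for a smaller determinant.

-- Signs of closed walks, and switching functions of balanced graphs.

module Walks {V : Set} (_≟_ : DecidableEquality V) (Γ : SignedGraph V) where
  open SignedGraph Γ
  open import Data.List.Membership.DecPropositional _≟_ using (_∈?_)
  open ≡.≡-Reasoning

  Walk : V → V → Set
  Walk = Star _~_

  ∣_∣ : ∀ {u v} → Walk u v → ℕ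
  ∣ w ∣ = length (starts Γ w)

  walkSign : ∀ {u v} → Walk u v → Sign
  walkSign ε                 = Sign.+
  walkSign (_◅_ {u} {v} _ w) = σ u v Sign.* walkSign w

  walkSign-◅◅ : ∀ {u v x} (w : Walk u v) (w′ : Walk v x) →
                walkSign (w ◅◅ w′) ≡ walkSign w Sign.* walkSign w′
  walkSign-◅◅ ε                 w′ = ≡.refl
  walkSign-◅◅ (_◅_ {u} {v} _ w) w′ =
    ≡.trans (≡.cong (σ u v Sign.*_) (walkSign-◅◅ w w′)) (≡.sym (Sign.*-assoc (σ u v) _ _))

  ∣∣-◅◅ : ∀ {u v x} (w : Walk u v) (w′ : Walk v x) → ∣ w ◅◅ w′ ∣ ≡ ∣ w ∣ ℕ.+ ∣ w′ ∣
  ∣∣-◅◅ ε       w′ = ≡.refl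
  ∣∣-◅◅ (_ ◅ w) w′ = ≡.cong suc (∣∣-◅◅ w w′)

  parity : ℕ → Sign
  parity zero    = Sign.+
  parity (suc n) = Sign.opposite (parity n)

  parity-even : ∀ q → parity (q ℕ.* 2) ≡ Sign.+
  parity-even zero    = ≡.refl
  parity-even (suc q) = ≡.cong (λ s → Sign.opposite (Sign.opposite s)) (parity-even q)

  parity-negativeEdges : ∀ {u v} (w : Walk u v) → parity (negativeEdges Γ w) ≡ walkSign w
  parity-negativeEdges ε = ≡.refl
  parity-negativeEdges (_◅_ {u} {v} _ w) with σ u v
  ... | Sign.+ = parity-negativeEdges w
  ... | Sign.- = ≡.cong Sign.opposite (parity-negativeEdges w)

  even⇒positive : ∀ {u v} (w : Walk u v) → 2 ∣ negativeEdges Γ w → walkSign w ≡ Sign.+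
  even⇒positive w (divides q eq) =
    ≡.trans (≡.sym (parity-negativeEdges w)) (≡.trans (≡.cong parity eq) (parity-even q))

  -- The positivity conditions make both closed walks obtained from a closed `w` strictly shorter:
  -- `loop` because `after` is nonempty, and `before ◅◅ after` because `loop` is nonempty.
  record Detour {u v} (w : Walk u v) : Set where
    constructor detour
    field
      {vertex}  : V
      before    : Walk u vertex
      loop      : Walk vertex vertex
      after     : Walk vertex v
      loop-pos  : 1 ℕ.≤ ∣ loop ∣
      after-pos : 1 ℕ.≤ ∣ after ∣
      splits    : w ≡ before ◅◅ (loop ◅◅ after)

  split-at : ∀ {u v x} (w : Walk u v) → x ∈ starts Γ w →
             ∃₂ λ (a : Walk u x) (b : Walk x v) → 1 ℕ.≤ ∣ b ∣ × w ≡ a ◅◅ b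
  split-at (e ◅ w) (here ≡.refl) = ε , e ◅ w , s≤s z≤n , ≡.refl
  split-at (e ◅ w) (there x∈w) with split-at w x∈w
  ... | a , b , b-pos , eq = e ◅ a , b , b-pos , ≡.cong (e ◅_) eq

  unique⊎detour : ∀ {u v} (w : Walk u v) → Unique (starts Γ w) ⊎ Detour w
  unique⊎detour ε = inj₁ []
  unique⊎detour (_◅_ {u} e w) with unique⊎detour w
  ... | inj₂ (detour a c b c-pos b-pos eq) =
    inj₂ (detour (e ◅ a) c b c-pos b-pos (≡.cong (e ◅_) eq))
  ... | inj₁ unique with u ∈? starts Γ w
  ...   | no u∉w = inj₁ (¬Any⇒All¬ _ u∉w ∷ unique)
  ...   | yes u∈w with split-at w u∈w
  ...     | a , b , b-pos , eq = inj₂ (detour ε (e ◅ a) b (s≤s z≤n) b-pos (≡.cong (e ◅_) eq))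

  module _ (balanced : Balanced Γ) where

    -- Closed walks of fewer than three steps are not cycles, so balance says nothing about them:
    -- one step would be a loop, and two steps use the same edge back and forth, which squares its
    -- sign.
    unique-closed-positive : ∀ {v} (w : Walk v v) → Unique (starts Γ w) → walkSign w ≡ Sign.+
    unique-closed-positive ε             _ = ≡.refl
    unique-closed-positive (e ◅ ε)       _ = contradiction e ~-irrefl
    unique-closed-positive (_◅_ {u} {v} e (f ◅ ε)) _ = begin
      σ u v Sign.* (σ v u Sign.* Sign.+)  ≡⟨ ≡.cong (σ u v Sign.*_) (Sign.*-identityʳ (σ v u)) ⟩
      σ u v Sign.* σ v u                  ≡⟨ ≡.cong (σ u v Sign.*_) (σ-sym f) ⟩
      σ u v Sign.* σ u v                  ≡⟨ Sign.s*s≡+ (σ u v) ⟩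
      Sign.+                              ∎
    unique-closed-positive w@(_ ◅ _ ◅ _ ◅ _) unique =
      even⇒positive w (balanced w (s≤s (s≤s (s≤s z≤n)) , unique))

    -- A closed walk that repeats a vertex splits into two shorter closed walks.
    closed-positive-≤ : ∀ n {v} (w : Walk v v) → ∣ w ∣ ℕ.≤ n → walkSign w ≡ Sign.+
    closed-positive-≤ zero    ε w≤n = ≡.refl
    closed-positive-≤ (suc n) w w≤n with unique⊎detour w
    ... | inj₁ unique = unique-closed-positive w unique
    ... | inj₂ (detour a c b c-pos b-pos ≡.refl) = begin
      walkSign (a ◅◅ (c ◅◅ b))
        ≡⟨ walkSign-◅◅ a (c ◅◅ b) ⟩
      walkSign a Sign.* walkSign (c ◅◅ b)
        ≡⟨ ≡.cong (walkSign a Sign.*_) (walkSign-◅◅ c b) ⟩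
      walkSign a Sign.* (walkSign c Sign.* walkSign b)
        ≡⟨ ≡.cong (λ s → walkSign a Sign.* (s Sign.* walkSign b)) (closed-positive-≤ n c c≤n) ⟩
      walkSign a Sign.* walkSign b
        ≡⟨ walkSign-◅◅ a b ⟨
      walkSign (a ◅◅ b)
        ≡⟨ closed-positive-≤ n (a ◅◅ b) ab≤n ⟩
      Sign.+ ∎
      where
      total : ∣ a ∣ ℕ.+ (∣ c ∣ ℕ.+ ∣ b ∣) ℕ.≤ suc n
      total = ℕ.≤-trans (ℕ.≤-reflexive (≡.sym (≡.trans (∣∣-◅◅ a (c ◅◅ b))
                (≡.cong (∣ a ∣ ℕ.+_) (∣∣-◅◅ c b))))) w≤n
      c≤n : ∣ c ∣ ℕ.≤ n
      c≤n = ℕ.s≤s⁻¹ (ℕ.≤-trans (ℕ.≤-trans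
        (ℕ.≤-trans (ℕ.≤-reflexive (ℕ.+-comm 1 ∣ c ∣)) (ℕ.+-monoʳ-≤ ∣ c ∣ b-pos))
        (ℕ.m≤n+m _ ∣ a ∣)) total)
      ab≤n : ∣ a ◅◅ b ∣ ℕ.≤ n
      ab≤n = ℕ.s≤s⁻¹ (ℕ.≤-trans (ℕ.≤-trans
        (ℕ.≤-reflexive (≡.trans (≡.cong suc (∣∣-◅◅ a b)) (≡.sym (ℕ.+-suc ∣ a ∣ ∣ b ∣))))
        (ℕ.+-monoʳ-≤ ∣ a ∣ (ℕ.+-monoˡ-≤ ∣ b ∣ c-pos))) total)

    closed-positive : ∀ {v} (w : Walk v v) → walkSign w ≡ Sign.+
    closed-positive w = closed-positive-≤ ∣ w ∣ w ℕ.≤-refl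

    -- `θ v` is the sign of the chosen walk from the base vertex `r` to `v`. Positivity of the
    -- closed walk through `r`, `u`, `v` and back relates `σ u v` to the return walk from `v`;
    -- positivity of going to `v` and back identifies the sign of that return walk with `θ v`.
    switching : Connected Γ → ∃ λ (θ : V → Sign) → ∀ {u v} → u ~ v → σ u v ≡ θ u Sign.* θ v
    switching (r , connect) = (λ v → walkSign (connect r v)) , λ {u} {v} u~v →
      solve-sign (walkSign (connect r u)) (σ u v) (walkSign (connect v r)) (walkSign (connect r v))
        (≡.trans (≡.sym (walkSign-◅◅ (connect r u) (u~v ◅ connect v r)))
                 (closed-positive (connect r u ◅◅ (u~v ◅ connect v r))))
        (≡.trans (≡.sym (walkSign-◅◅ (connect r v) (connect v r)))
                 (closed-positive (connect r v ◅◅ connect v r)))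
      where
      solve-sign : ∀ a s b c → a Sign.* (s Sign.* b) ≡ Sign.+ → c Sign.* b ≡ Sign.+ →
                   s ≡ a Sign.* c
      solve-sign Sign.+ Sign.+ Sign.+ Sign.+ _ _ = ≡.refl
      solve-sign Sign.+ Sign.- Sign.- Sign.- _ _ = ≡.refl
      solve-sign Sign.- Sign.+ Sign.- Sign.- _ _ = ≡.refl
      solve-sign Sign.- Sign.- Sign.+ Sign.+ _ _ = ≡.refl

-- Determinants as alternating multilinear functions of the rows, and multiplicativity.

module Determinant {c ℓ₁ ℓ₂} (F : EuclideanField c ℓ₁ ℓ₂) where
  open EuclideanField F using (commutativeRing)
  open CommutativeRing commutativeRing hiding (zero)
  open Spectral F
  open RingProperties ring
  open SumProperties semiring hiding (sum)
  open SemiringSolver commutativeSemiring using (solve; _:=_; _:+_; _:*_; con)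
  open SetoidReasoning setoid

  Rows : ℕ → ℕ → Set c
  Rows m n = Vector (Vector Carrier n) m

  infix 4 _≋_
  _≋_ : ∀ {m n} → Rows m n → Rows m n → Set ℓ₁
  A ≋ B = ∀ i j → A i j ≈ B i j

  sum-cong : ∀ {n} {f g : Vector Carrier n} → (∀ i → f i ≈ g i) → sum f ≈ sum g
  sum-cong = sum-cong-≋

  sum-+ : ∀ {n} (f g : Vector Carrier n) → sum (λ i → f i + g i) ≈ sum f + sum g
  sum-+ f g = ∑-distrib-+ f g

  sum-*ˡ : ∀ {n} a (f : Vector Carrier n) → sum (λ i → a * f i) ≈ a * sum f
  sum-*ˡ a f = sym (*-distribˡ-sum a f)

  sum-swap : ∀ {m n} (f : Fin m → Fin n → Carrier) →
             sum (λ i → sum λ j → f i j) ≈ sum (λ j → sum λ i → f i j)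
  sum-swap f = ∑-comm f

  sum-zero : ∀ {n} {f : Vector Carrier n} → (∀ i → f i ≈ 0#) → sum f ≈ 0#
  sum-zero {n} f≈0 = trans (sum-cong f≈0) (sum-replicate-zero n)

  sign : ∀ {n} → Fin n → Carrier
  sign j = (- 1#) ^ toℕ j

  minor : ∀ {n} → Rows (suc n) (suc n) → Fin (suc n) → Rows n n
  minor M j r s = M (suc r) (punchIn j s)

  det-cong : ∀ {n} {A B : Rows n n} → A ≋ B → det A ≈ det B
  det-cong {zero}  A≋B = refl
  det-cong {suc n} {A} {B} A≋B = sum-cong λ j →
    *-congˡ {x = sign j} (*-cong (A≋B zero j) (det-cong λ r s → A≋B (suc r) (punchIn j s)))

  -- The rows are peeled off from the top, as in the definition of det.
  record IsAlternatingStep {n N} (Alternatingₙ : (Rows n N → Carrier) → Set (c ⊔ ℓ₁))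
                           (D : Rows (suc n) N → Carrier) : Set (c ⊔ ℓ₁) where
    field
      cong   : ∀ {R S} → R ≋ S → D R ≈ D S
      add    : ∀ v w R → D ((λ j → v j + w j) ∷ᵛ R) ≈ D (v ∷ᵛ R) + D (w ∷ᵛ R)
      scale  : ∀ a v R → D ((λ j → a * v j) ∷ᵛ R) ≈ a * D (v ∷ᵛ R)
      rest   : ∀ v → Alternatingₙ (λ R → D (v ∷ᵛ R))
      repeat : ∀ v R i → R i ≡ v → D (v ∷ᵛ R) ≈ 0#

  -- The width `N` is independent of the number of rows, so that `rest` stays within the same
  -- notion. With no rows left only congruence remains; it still has content, since two empty
  -- families of rows need not be definitionally equal.
  Alternating : ∀ {N} n → (Rows n N → Carrier) → Set (c ⊔ ℓ₁)
  Alternating zero    D = ∀ {R S} → R ≋ S → D R ≈ D S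
  Alternating (suc n) D = IsAlternatingStep (Alternating n) D

  open IsAlternatingStep

  ∷-tail : ∀ {n} {A : Set c} (v : Vector A (suc n)) → v ≗ v zero ∷ᵛ tail v
  ∷-tail v zero    = ≡.refl
  ∷-tail v (suc i) = ≡.refl

  row-≋ : ∀ {m n} {R S : Rows m n} → R ≗ S → R ≋ S
  row-≋ R≗S i j = reflexive (≡.cong (λ r → r j) (R≗S i))

  ∷-cong : ∀ {m n} {v w : Vector Carrier n} {R S : Rows m n} →
             (∀ j → v j ≈ w j) → R ≋ S → v ∷ᵛ R ≋ w ∷ᵛ S
  ∷-cong v≈w R≋S zero    = v≈w
  ∷-cong v≈w R≋S (suc i) = R≋S i

  -- This and the closure properties below serve `det-rest`: by Laplace expansion, `det (v ∷ᵛ R)` is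
  -- a sum of multiples of determinants of column selections of `R`.
  alternating-sum : ∀ {N k} n {D : Fin k → Rows n N → Carrier} →
                    (∀ i → Alternating n (D i)) →
                    Alternating n (λ R → sum λ i → D i R)
  alternating-sum zero    alt = λ R≋S → sum-cong λ i → alt i R≋S
  alternating-sum (suc n) {D} alt = record
    { cong   = λ R≋S → sum-cong λ i → cong (alt i) R≋S
    ; add    = λ v w R → trans (sum-cong λ i → add (alt i) v w R)
                 (sum-+ (λ i → D i (v ∷ᵛ R)) (λ i → D i (w ∷ᵛ R)))
    ; scale  = λ a v R → trans (sum-cong λ i → scale (alt i) a v R)
                 (sum-*ˡ a (λ i → D i (v ∷ᵛ R)))
    ; rest   = λ v → alternating-sum n λ i → rest (alt i) v
    ; repeat = λ v R r eq → sum-zero λ i → repeat (alt i) v R r eq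
    }

  alternating-scale : ∀ {N} n {D : Rows n N → Carrier} b → Alternating n D →
                      Alternating n (λ R → b * D R)
  alternating-scale zero    b alt = λ R≋S → *-congˡ (alt R≋S)
  alternating-scale (suc n) b alt = record
    { cong   = λ R≋S → *-congˡ (cong alt R≋S)
    ; add    = λ v w R → trans (*-congˡ (add alt v w R)) (distribˡ b _ _)
    ; scale  = λ a v R → trans (*-congˡ (scale alt a v R))
                 (solve 3 (λ b a d → b :* (a :* d) := a :* (b :* d)) refl b a _)
    ; rest   = λ v → alternating-scale n b (rest alt v)
    ; repeat = λ v R r eq → trans (*-congˡ (repeat alt v R r eq)) (zeroʳ b)
    }

  alternating-ext : ∀ {N} n {D E : Rows n N → Carrier} → (∀ R → D R ≈ E R) →
                    Alternating n D → Alternating n E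
  alternating-ext zero    D≈E alt = λ R≋S →
    trans (sym (D≈E _)) (trans (alt R≋S) (D≈E _))
  alternating-ext (suc n) D≈E alt = record
    { cong   = λ R≋S → trans (sym (D≈E _)) (trans (cong alt R≋S) (D≈E _))
    ; add    = λ v w R → trans (sym (D≈E _)) (trans (add alt v w R) (+-cong (D≈E _) (D≈E _)))
    ; scale  = λ a v R → trans (sym (D≈E _)) (trans (scale alt a v R) (*-congˡ (D≈E _)))
    ; rest   = λ v → alternating-ext n (λ R → D≈E (v ∷ᵛ R)) (rest alt v)
    ; repeat = λ v R r eq → trans (sym (D≈E _)) (repeat alt v R r eq)
    }

  map-∷ : ∀ {m n k} (f : Fin k → Fin n) (v : Vector Carrier n) (R : Rows m n) →
          (λ r s → (v ∷ᵛ R) r (f s)) ≋ ((v ∘ f) ∷ᵛ (λ r → R r ∘ f))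
  map-∷ f v R zero    j = refl
  map-∷ f v R (suc i) j = refl

  alternating-columns : ∀ {N k} n {D : Rows n k → Carrier} (f : Fin k → Fin N) →
                        Alternating n D → Alternating n (λ R → D (λ r s → R r (f s)))
  alternating-columns zero    f alt = λ R≋S → alt λ r s → R≋S r (f s)
  alternating-columns (suc n) {D} f alt = record
    { cong   = λ R≋S → cong alt λ r s → R≋S r (f s)
    ; add    = λ v w R → trans (cong alt (map-∷ f _ R)) (trans (add alt _ _ _)
                 (sym (+-cong (cong alt (map-∷ f v R)) (cong alt (map-∷ f w R)))))
    ; scale  = λ a v R → trans (cong alt (map-∷ f _ R)) (trans (scale alt a _ _)
                 (sym (*-congˡ (cong alt (map-∷ f v R)))))
    ; rest   = λ v → alternating-ext n (λ R → sym (cong alt (map-∷ f v R)))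
                 (alternating-columns n f (rest alt (v ∘ f)))
    ; repeat = λ v R r eq → trans (cong alt (map-∷ f v R))
                 (repeat alt _ _ r (≡.cong (_∘ f) eq))
    }

  -- The double Laplace expansion of a determinant whose two top rows are both `v`; `φ` stands for
  -- the minor of the other rows as a function of the surviving columns. The terms in which the
  -- first row uses column `zero` cancel those in which the second row does, and the remaining terms
  -- form `residue`. Extensionality of `φ` is assumed because composites of `punchIn` agree only
  -- pointwise.
  double-expansion : ∀ n (v : Vector Carrier (2 ℕ.+ n))
    (φ : (Fin n → Fin (2 ℕ.+ n)) → Carrier) → (∀ {f g} → f ≗ g → φ f ≈ φ g) →
    sum (λ j → sign j * (v j * sum λ k →
      sign k * (v (punchIn j k) * φ (punchIn j ∘ punchIn k)))) ≈ 0#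
  double-expansion n v φ φ-cong = begin
    1# * (v zero * S) + sum (λ j → - 1# * sign j * (v (suc j) *
      (1# * (v zero * φ (suc ∘ punchIn j)) + T j)))
      ≈⟨ +-cong (*-identityˡ _) (sum-cong step) ⟩
    v zero * S + sum (λ j → - (v zero * s j) + t j)
      ≈⟨ +-congˡ (sum-+ (λ j → - (v zero * s j)) t) ⟩
    v zero * S + (sum (λ j → - (v zero * s j)) + sum t)
      ≈⟨ +-congˡ (+-cong (trans (sum-cong λ j → -‿distribˡ-* (v zero) (s j))
                           (trans (sum-*ˡ (- v zero) s) (sym (-‿distribˡ-* (v zero) S))))
                         (residue n v φ φ-cong)) ⟩
    v zero * S + (- (v zero * S) + 0#)
      ≈⟨ trans (+-congˡ (+-identityʳ _)) (-‿inverseʳ _) ⟩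
    0# ∎
    where
    s : Fin (suc n) → Carrier
    s k = sign k * (v (suc k) * φ (suc ∘ punchIn k))
    S = sum s
    T : Fin (suc n) → Carrier
    T j = sum λ k → - 1# * sign k * (v (suc (punchIn j k)) * φ (punchIn (suc j) ∘ punchIn (suc k)))
    t : Fin (suc n) → Carrier
    t j = sign j * (v (suc j) * (- T j))

    step : ∀ j → - 1# * sign j * (v (suc j) * (1# * (v zero * φ (suc ∘ punchIn j)) + T j))
               ≈ - (v zero * s j) + t j
    step j = begin
      - 1# * sign j * (v (suc j) * (1# * (v zero * φ′) + T j))
        ≈⟨ solve 6 (λ m s v1 v0 p t → m :* s :* (v1 :* (con 1 :* (v0 :* p) :+ t))
             := m :* (v0 :* (s :* (v1 :* p))) :+ s :* (v1 :* (m :* t)))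
             refl (- 1#) (sign j) (v (suc j)) (v zero) φ′ (T j) ⟩
      - 1# * (v zero * s j) + sign j * (v (suc j) * (- 1# * T j))
        ≈⟨ +-cong (-1*x≈-x _) (*-congˡ (*-congˡ (-1*x≈-x _))) ⟩
      - (v zero * s j) + t j ∎
      where φ′ = φ (suc ∘ punchIn j)

    -- The pairs of columns avoiding the first one: the same double sum one size down.
    residue : ∀ n (v : Vector Carrier (2 ℕ.+ n))
      (φ : (Fin n → Fin (2 ℕ.+ n)) → Carrier) → (∀ {f g} → f ≗ g → φ f ≈ φ g) →
      sum (λ j → sign j * (v (suc j) * (- sum (λ k → - 1# * sign k *
        (v (suc (punchIn j k)) * φ (punchIn (suc j) ∘ punchIn (suc k))))))) ≈ 0#
    residue zero    v φ φ-cong = sum-zero {f = λ j → sign j * (v (suc j) * (- 0#))} λ j →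
      trans (*-congˡ (trans (*-congˡ -0#≈0#) (zeroʳ _))) (zeroʳ _)
    residue (suc n) v φ φ-cong = trans
      (sum-cong λ j → *-congˡ {x = sign j} (*-congˡ {x = v (suc j)} (trans
        (sym (-1*x≈-x _)) (trans (sym (sum-*ˡ (- 1#) (u j))) (sum-cong (inner j))))))
      (double-expansion n (tail v) (λ f → φ (zero ∷ᵛ (suc ∘ f)))
        λ f≗g → φ-cong λ { zero → ≡.refl ; (suc i) → ≡.cong suc (f≗g i) })
      where
      u : ∀ j → Fin (suc n) → Carrier
      u j k = - 1# * sign k *
        (v (suc (punchIn j k)) * φ (punchIn (suc j) ∘ punchIn (suc k)))
      inner : ∀ j k → - 1# * u j k ≈ sign k *
        (v (suc (punchIn j k)) * φ (zero ∷ᵛ (suc ∘ punchIn j ∘ punchIn k)))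
      -- Both column indices drop by one, so two factors `- 1#` appear and cancel. Column `zero`
      -- survives in every selection and becomes its fixed head.
      inner j k = begin
        - 1# * (- 1# * sign k * w)
          ≈⟨ solve 3 (λ m s w → m :* (m :* s :* w) := (m :* m) :* (s :* w)) refl (- 1#) (sign k) w ⟩
        (- 1# * - 1#) * (sign k * w)
          ≈⟨ *-congʳ (trans (-1*x≈-x _) (-‿involutive 1#)) ⟩
        1# * (sign k * w)
          ≈⟨ *-identityˡ _ ⟩
        sign k * w
          ≈⟨ *-congˡ (*-congˡ (φ-cong λ { zero → ≡.refl ; (suc i) → ≡.refl })) ⟩
        sign k * (v (suc (punchIn j k)) * φ (zero ∷ᵛ (suc ∘ punchIn j ∘ punchIn k))) ∎
        where w = v (suc (punchIn j k)) * φ (punchIn (suc j) ∘ punchIn (suc k))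

  det-first-two-equal : ∀ {n} (A : Rows (2 ℕ.+ n) (2 ℕ.+ n)) →
                        (∀ j → A (suc zero) j ≈ A zero j) → det A ≈ 0#
  det-first-two-equal {n} A eq = trans
    (sum-cong λ j → *-congˡ {x = sign j} (*-congˡ {x = A zero j} (sum-cong λ k →
      *-congˡ {x = sign k} (*-congʳ {x = det (λ r s → A (suc (suc r)) (punchIn j (punchIn k s)))}
        (eq (punchIn j k))))))
    (double-expansion n (A zero) (λ f → det (λ r s → A (suc (suc r)) (f s)))
      λ f≗g → det-cong λ r s → reflexive (≡.cong (A (suc (suc r))) (f≗g s)))

  -- Polarization: expand `D` with `v + w` in both top rows. The properties of `D` are passed one by
  -- one because `repeat` for `det` is itself derived through this lemma.
  swap-first-two : ∀ {n N} {D : Rows (2 ℕ.+ n) N → Carrier} →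
    (∀ v w R → D ((λ j → v j + w j) ∷ᵛ R) ≈ D (v ∷ᵛ R) + D (w ∷ᵛ R)) →
    (∀ v → Alternating (suc n) (λ R → D (v ∷ᵛ R))) →
    (∀ v R → D (v ∷ᵛ v ∷ᵛ R) ≈ 0#) →
    ∀ v w R → D (v ∷ᵛ w ∷ᵛ R) ≈ - D (w ∷ᵛ v ∷ᵛ R)
  swap-first-two {D = D} D-add D-rest D-repeat v w R = +-inverseˡ-unique _ _ (begin
    D (v ∷ᵛ w ∷ᵛ R) + D (w ∷ᵛ v ∷ᵛ R)
      ≈⟨ +-cong (+-identityˡ _) (+-identityʳ _) ⟨
    (0# + D (v ∷ᵛ w ∷ᵛ R)) + (D (w ∷ᵛ v ∷ᵛ R) + 0#)
      ≈⟨ +-cong (+-congʳ (D-repeat v R)) (+-congˡ (D-repeat w R)) ⟨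
    (D (v ∷ᵛ v ∷ᵛ R) + D (v ∷ᵛ w ∷ᵛ R)) + (D (w ∷ᵛ v ∷ᵛ R) + D (w ∷ᵛ w ∷ᵛ R))
      ≈⟨ +-cong (add (D-rest v) v w R) (add (D-rest w) v w R) ⟨
    D (v ∷ᵛ u ∷ᵛ R) + D (w ∷ᵛ u ∷ᵛ R)
      ≈⟨ D-add v w (u ∷ᵛ R) ⟨
    D (u ∷ᵛ u ∷ᵛ R)
      ≈⟨ D-repeat u R ⟩
    0# ∎)
    where u = λ j → v j + w j

  -- When the copy of `v` lies below the second row, swapping the top two rows brings `v` under a
  -- fixed top row together with its copy, where `D-rest` applies.
  repeat-from-first-two : ∀ {n N} {D : Rows (2 ℕ.+ n) N → Carrier} →
    (∀ {R S} → R ≋ S → D R ≈ D S) →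
    (∀ v w R → D ((λ j → v j + w j) ∷ᵛ R) ≈ D (v ∷ᵛ R) + D (w ∷ᵛ R)) →
    (∀ v → Alternating (suc n) (λ R → D (v ∷ᵛ R))) →
    (∀ v R → D (v ∷ᵛ v ∷ᵛ R) ≈ 0#) →
    ∀ v R i → R i ≡ v → D (v ∷ᵛ R) ≈ 0#
  repeat-from-first-two D-cong D-add D-rest D-repeat v R zero ≡.refl =
    trans (D-cong (∷-cong (λ _ → refl) (row-≋ (∷-tail R)))) (D-repeat v (tail R))
  repeat-from-first-two {D = D} D-cong D-add D-rest D-repeat v R (suc i) eq = begin
    D (v ∷ᵛ R)                    ≈⟨ D-cong (∷-cong (λ _ → refl) (row-≋ (∷-tail R))) ⟩
    D (v ∷ᵛ R zero ∷ᵛ tail R)      ≈⟨ swap-first-two {D = D} D-add D-rest D-repeat v (R zero) (tail R) ⟩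
    - D (R zero ∷ᵛ v ∷ᵛ tail R)    ≈⟨ -‿cong (repeat (D-rest (R zero)) v (tail R) i eq) ⟩
    - 0#                         ≈⟨ -0#≈0# ⟩
    0#                           ∎

  det-alternating : ∀ n → Alternating n (det {n})
  det-alternating zero    = det-cong
  det-alternating (suc n) = record
    { cong   = det-cong
    ; add    = det-add
    ; scale  = λ a v R → trans (sum-cong λ j →
                 solve 4 (λ s a v d → s :* (a :* v :* d) := a :* (s :* (v :* d))) refl
                   (sign j) a (v j) (det λ r s → R r (punchIn j s)))
                 (sum-*ˡ a (term v R))
    ; rest   = det-rest
    ; repeat = det-repeat n det-rest
    }
    where
    term : ∀ {n} → Vector Carrier (suc n) → Rows n (suc n) → Fin (suc n) → Carrier
    term v R j = sign j * (v j * det (λ r s → R r (punchIn j s)))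
    det-add : ∀ {n} v w R →
      det {suc n} ((λ j → v j + w j) ∷ᵛ R) ≈ det (v ∷ᵛ R) + det (w ∷ᵛ R)
    det-add v w R = trans (sum-cong λ j →
      solve 4 (λ s v w d → s :* ((v :+ w) :* d) := s :* (v :* d) :+ s :* (w :* d)) refl
        (sign j) (v j) (w j) (det λ r s → R r (punchIn j s)))
      (sum-+ (term v R) (term w R))
    det-rest : ∀ v → Alternating n (λ R → det (v ∷ᵛ R))
    det-rest v = alternating-sum n λ j → alternating-scale n (sign j)
      (alternating-scale n (v j) (alternating-columns n (punchIn j) (det-alternating n)))
    det-repeat : ∀ n → (∀ v → Alternating n (λ R → det (v ∷ᵛ R))) →
                 ∀ v (R : Rows n (suc n)) i → R i ≡ v → det (v ∷ᵛ R) ≈ 0#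
    det-repeat (suc n) rst = repeat-from-first-two {D = det} det-cong det-add rst
      (λ v R → det-first-two-equal (v ∷ᵛ v ∷ᵛ R) λ _ → refl)

  infixl 7 _⊗_
  _⊗_ : ∀ {l m n} → Rows l m → Rows m n → Rows l n
  (A ⊗ B) i k = sum λ j → A i j * B j k

  alternating-row-sum : ∀ {n N k} {D : Rows (suc n) N → Carrier} → Alternating (suc n) D →
    ∀ (a : Vector Carrier k) (B : Rows k N) R →
    D ((λ s → sum λ j → a j * B j s) ∷ᵛ R) ≈ sum λ j → a j * D (B j ∷ᵛ R)
  alternating-row-sum {k = zero} {D} alt a B R = begin
    D ((λ _ → 0#) ∷ᵛ R)       ≈⟨ cong alt (∷-cong (λ _ → zeroˡ 0#) λ _ _ → refl) ⟨
    D ((λ _ → 0# * 0#) ∷ᵛ R)  ≈⟨ scale alt 0# (λ _ → 0#) R ⟩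
    0# * D ((λ _ → 0#) ∷ᵛ R)  ≈⟨ zeroˡ _ ⟩
    0#                       ∎
  alternating-row-sum {k = suc k} {D} alt a B R = begin
    D ((λ s → a zero * B zero s + sum λ j → a (suc j) * B (suc j) s) ∷ᵛ R)
      ≈⟨ add alt (λ s → a zero * B zero s) _ R ⟩
    D ((λ s → a zero * B zero s) ∷ᵛ R) + D ((λ s → sum λ j → a (suc j) * B (suc j) s) ∷ᵛ R)
      ≈⟨ +-cong (scale alt (a zero) (B zero) R)
                (alternating-row-sum alt (a ∘ suc) (B ∘ suc) R) ⟩
    a zero * D (B zero ∷ᵛ R) + sum (λ j → a (suc j) * D (B (suc j) ∷ᵛ R)) ∎

  -- Expanding row by row, every term that has `b` itself as a row dies. In `alternating-⊗` the
  -- vector `b` is the fixed row `B k` on top, and this strips the multiple of `B k` from all rows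
  -- below.
  alternating-absorb : ∀ {N} n {D : Rows n N → Carrier} → Alternating n D →
    ∀ b → (∀ R i → R i ≡ b → D R ≈ 0#) →
    ∀ (a : Vector Carrier n) R → D (λ i s → a i * b s + R i s) ≈ D R
  alternating-absorb zero    alt b D-vanish a R = alt λ ()
  alternating-absorb (suc n) {D} alt b D-vanish a R = begin
    D (λ i s → a i * b s + R i s)
      ≈⟨ cong alt (row-≋ (∷-tail λ i s → a i * b s + R i s)) ⟩
    D ((λ s → a zero * b s + R zero s) ∷ᵛ Q)
      ≈⟨ add alt (λ s → a zero * b s) (R zero) Q ⟩
    D ((λ s → a zero * b s) ∷ᵛ Q) + D (R zero ∷ᵛ Q)
      ≈⟨ +-cong (scale alt (a zero) b Q)
           (alternating-absorb n (rest alt (R zero)) b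
             (λ S i → D-vanish (R zero ∷ᵛ S) (suc i)) (a ∘ suc) (tail R)) ⟩
    a zero * D (b ∷ᵛ Q) + D (R zero ∷ᵛ tail R)
      ≈⟨ +-cong (trans (*-congˡ (D-vanish (b ∷ᵛ Q) zero ≡.refl)) (zeroʳ _))
           (sym (cong alt (row-≋ (∷-tail R)))) ⟩
    0# + D R
      ≈⟨ +-identityˡ _ ⟩
    D R ∎
    where Q = λ i s → a (suc i) * b s + R (suc i) s

  -- Row `k` reaches the front by `k` adjacent transpositions. Undoing the topmost one first leaves
  -- the same problem below a fixed row.
  alternating-move : ∀ {N} n {D : Rows (suc n) N → Carrier} → Alternating (suc n) D →
    ∀ B k → D (B k ∷ᵛ (B ∘ punchIn k)) ≈ sign k * D B
  alternating-move n       alt B zero    =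
    trans (cong alt λ i j → sym (row-≋ (∷-tail B) i j)) (sym (*-identityˡ _))
  alternating-move (suc n) {D} alt B (suc k) = begin
    D (B (suc k) ∷ᵛ (B ∘ punchIn (suc k)))
      ≈⟨ cong alt (∷-cong (λ _ → refl) (row-≋ (∷-tail (B ∘ punchIn (suc k))))) ⟩
    D (B (suc k) ∷ᵛ B zero ∷ᵛ (B ∘ suc ∘ punchIn k))
      ≈⟨ swap-first-two {D = D} (add alt) (rest alt) (λ v R → repeat alt v (v ∷ᵛ R) zero ≡.refl)
           (B (suc k)) (B zero) (B ∘ suc ∘ punchIn k) ⟩
    - D (B zero ∷ᵛ B (suc k) ∷ᵛ (B ∘ suc ∘ punchIn k))
      ≈⟨ -‿cong (alternating-move n (rest alt (B zero)) (tail B) k) ⟩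
    - (sign k * D (B zero ∷ᵛ tail B))
      ≈⟨ -‿cong (*-congˡ (cong alt (row-≋ (∷-tail B)))) ⟨
    - (sign k * D B)
      ≈⟨ trans (*-assoc _ _ _) (-1*x≈-x _) ⟨
    - 1# * sign k * D B ∎

  -- Expanding row 0 of A ⊗ B puts B k in front; absorbing B k then deletes column k of A,
  -- so the minors of the Laplace expansion of det A appear.
  alternating-⊗ : ∀ {N} n {D : Rows n N → Carrier} → Alternating n D →
    ∀ A B → D (A ⊗ B) ≈ det A * D B
  alternating-⊗ zero    {D} alt A B = trans (alt λ ()) (sym (*-identityˡ (D B)))
  alternating-⊗ (suc n) {D} alt A B = begin
    D (A ⊗ B)
      ≈⟨ cong alt (row-≋ (∷-tail (A ⊗ B))) ⟩
    D ((A ⊗ B) zero ∷ᵛ tail (A ⊗ B))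
      ≈⟨ alternating-row-sum alt (A zero) B (tail (A ⊗ B)) ⟩
    sum (λ k → A zero k * D (B k ∷ᵛ tail (A ⊗ B)))
      ≈⟨ sum-cong (λ k → *-congˡ {x = A zero k} (step k)) ⟩
    sum (λ k → A zero k * (det (minor A k) * (sign k * D B)))
      ≈⟨ sum-cong (λ k → solve 4 (λ a d s e → a :* (d :* (s :* e)) := e :* (s :* (a :* d))) refl
           (A zero k) (det (minor A k)) (sign k) (D B)) ⟩
    sum (λ k → D B * (sign k * (A zero k * det (minor A k))))
      ≈⟨ sum-*ˡ (D B) (λ k → sign k * (A zero k * det (minor A k))) ⟩
    D B * det A
      ≈⟨ *-comm _ _ ⟩
    det A * D B ∎
    where
    step : ∀ k → D (B k ∷ᵛ tail (A ⊗ B)) ≈ det (minor A k) * (sign k * D B)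
    step k = begin
      D (B k ∷ᵛ tail (A ⊗ B))
        ≈⟨ cong alt (∷-cong (λ _ → refl) λ i s → sum-remove {i = k} λ j → A (suc i) j * B j s) ⟩
      D (B k ∷ᵛ (λ i s → A (suc i) k * B k s + (minor A k ⊗ (B ∘ punchIn k)) i s))
        ≈⟨ alternating-absorb n (rest alt (B k)) (B k) (λ R i → repeat alt (B k) R i)
             (λ i → A (suc i) k) (minor A k ⊗ (B ∘ punchIn k)) ⟩
      D (B k ∷ᵛ (minor A k ⊗ (B ∘ punchIn k)))
        ≈⟨ alternating-⊗ n (rest alt (B k)) (minor A k) (B ∘ punchIn k) ⟩
      det (minor A k) * D (B k ∷ᵛ (B ∘ punchIn k))
        ≈⟨ *-congˡ (alternating-move n alt B k) ⟩
      det (minor A k) * (sign k * D B) ∎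

  det-⊗ : ∀ {n} (A B : Rows n n) → det (A ⊗ B) ≈ det A * det B
  det-⊗ {n} = alternating-⊗ n (det-alternating n)

  -- Scalar and block matrices.

  -- Written exactly as the diagonal part of `charMatrix`, so that `charMatrix M x` is `scalar x`
  -- minus `M` by definition. Removing the first row and column also gives a smaller `scalar z` by
  -- computation.
  scalar : ∀ {n} → Carrier → Rows n n
  scalar z i j = if does (i Fin.≟ j) then z else 0#

  𝟎 : ∀ {m n} → Rows m n
  𝟎 _ _ = 0#

  sum-scalarˡ : ∀ {n} z (i : Fin n) (f : Vector Carrier n) → sum (λ j → scalar z i j * f j) ≈ z * f i
  sum-scalarˡ z zero    f = trans (+-congˡ (sum-zero λ j → zeroˡ (f (suc j)))) (+-identityʳ _)
  sum-scalarˡ z (suc i) f = trans (+-cong (zeroˡ _) (sum-scalarˡ z i (f ∘ suc))) (+-identityˡ _)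

  sum-scalarʳ : ∀ {n} z (k : Fin n) (f : Vector Carrier n) → sum (λ j → f j * scalar z j k) ≈ f k * z
  sum-scalarʳ z zero    f = trans (+-congˡ (sum-zero λ j → zeroʳ (f (suc j)))) (+-identityʳ _)
  sum-scalarʳ z (suc k) f = trans (+-cong (zeroʳ _) (sum-scalarʳ z k (f ∘ suc))) (+-identityˡ _)

  scalar-* : ∀ {n} x z (i j : Fin n) → x * scalar z i j ≈ scalar (x * z) i j
  scalar-* x z i j with does (i Fin.≟ j)
  ... | true  = refl
  ... | false = zeroʳ x

  scalar-cong : ∀ {n} {x y} → x ≈ y → scalar {n} x ≋ scalar y
  scalar-cong x≈y i j with does (i Fin.≟ j)
  ... | true  = x≈y
  ... | false = refl

  sum-split : ∀ m {n} (f : Fin (m ℕ.+ n) → Carrier) →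
              sum f ≈ sum (λ i → f (i ↑ˡ n)) + sum (λ j → f (m ↑ʳ j))
  sum-split zero    f = sym (+-identityˡ _)
  sum-split (suc m) f = trans (+-congˡ (sum-split m (f ∘ suc))) (sym (+-assoc _ _ _))

  ↑-elim : ∀ {p} m {n} (P : Fin (m ℕ.+ n) → Set p) →
           (∀ i → P (i ↑ˡ n)) → (∀ j → P (m ↑ʳ j)) → ∀ i → P i
  ↑-elim m {n} P left right i = ≡.subst P (Fin.join-splitAt m n i) (go (splitAt m i))
    where
    go : ∀ s → P (Fin.join m n s)
    go (inj₁ i) = left i
    go (inj₂ j) = right j

  block-≋ : ∀ m {n m′ n′} {R S : Rows (m ℕ.+ n) (m′ ℕ.+ n′)} →
    (∀ i j → R (i ↑ˡ n) (j ↑ˡ n′) ≈ S (i ↑ˡ n) (j ↑ˡ n′)) →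
    (∀ i j → R (i ↑ˡ n) (m′ ↑ʳ j) ≈ S (i ↑ˡ n) (m′ ↑ʳ j)) →
    (∀ i j → R (m ↑ʳ i) (j ↑ˡ n′) ≈ S (m ↑ʳ i) (j ↑ˡ n′)) →
    (∀ i j → R (m ↑ʳ i) (m′ ↑ʳ j) ≈ S (m ↑ʳ i) (m′ ↑ʳ j)) →
    R ≋ S
  block-≋ m {m′ = m′} r₁₁ r₁₂ r₂₁ r₂₂ = ↑-elim m _
    (λ i → ↑-elim m′ _ (r₁₁ i) (r₁₂ i))
    (λ i → ↑-elim m′ _ (r₂₁ i) (r₂₂ i))

  block : ∀ {m n m′ n′} → Rows m m′ → Rows m n′ → Rows n m′ → Rows n n′ →
          Rows (m ℕ.+ n) (m′ ℕ.+ n′)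
  block A B C D = (λ i → A i ++ᵛ B i) ++ᵛ (λ i → C i ++ᵛ D i)

  module _ {m n m′ n′} (A : Rows m m′) (B : Rows m n′) (C : Rows n m′) (D : Rows n n′) where

    top : ∀ i → block A B C D (i ↑ˡ n) ≡ A i ++ᵛ B i
    top i = lookup-++ˡ (λ i → A i ++ᵛ B i) (λ i → C i ++ᵛ D i) i

    bottom : ∀ i → block A B C D (m ↑ʳ i) ≡ C i ++ᵛ D i
    bottom i = lookup-++ʳ (λ i → A i ++ᵛ B i) (λ i → C i ++ᵛ D i) i

    block₁₁ : ∀ i j → block A B C D (i ↑ˡ n) (j ↑ˡ n′) ≡ A i j
    block₁₁ i j = ≡.trans (≡.cong (λ r → r (j ↑ˡ n′)) (top i)) (lookup-++ˡ (A i) (B i) j)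

    block₁₂ : ∀ i j → block A B C D (i ↑ˡ n) (m′ ↑ʳ j) ≡ B i j
    block₁₂ i j = ≡.trans (≡.cong (λ r → r (m′ ↑ʳ j)) (top i)) (lookup-++ʳ (A i) (B i) j)

    block₂₁ : ∀ i j → block A B C D (m ↑ʳ i) (j ↑ˡ n′) ≡ C i j
    block₂₁ i j = ≡.trans (≡.cong (λ r → r (j ↑ˡ n′)) (bottom i)) (lookup-++ˡ (C i) (D i) j)

    block₂₂ : ∀ i j → block A B C D (m ↑ʳ i) (m′ ↑ʳ j) ≡ D i j
    block₂₂ i j = ≡.trans (≡.cong (λ r → r (m′ ↑ʳ j)) (bottom i)) (lookup-++ʳ (C i) (D i) j)

  block-intro : ∀ {m n m′ n′} {R : Rows (m ℕ.+ n) (m′ ℕ.+ n′)} {A B C D} →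
    (∀ i j → R (i ↑ˡ n) (j ↑ˡ n′) ≈ A i j) → (∀ i j → R (i ↑ˡ n) (m′ ↑ʳ j) ≈ B i j) →
    (∀ i j → R (m ↑ʳ i) (j ↑ˡ n′) ≈ C i j) → (∀ i j → R (m ↑ʳ i) (m′ ↑ʳ j) ≈ D i j) →
    R ≋ block A B C D
  block-intro {m} {A = A} {B} {C} {D} r₁₁ r₁₂ r₂₁ r₂₂ = block-≋ m
    (λ i j → trans (r₁₁ i j) (reflexive (≡.sym (block₁₁ A B C D i j))))
    (λ i j → trans (r₁₂ i j) (reflexive (≡.sym (block₁₂ A B C D i j))))
    (λ i j → trans (r₂₁ i j) (reflexive (≡.sym (block₂₁ A B C D i j))))
    (λ i j → trans (r₂₂ i j) (reflexive (≡.sym (block₂₂ A B C D i j))))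

  block-cong : ∀ {m n m′ n′} {A A′ : Rows m m′} {B B′ : Rows m n′}
    {C C′ : Rows n m′} {D D′ : Rows n n′} →
    A ≋ A′ → B ≋ B′ → C ≋ C′ → D ≋ D′ → block A B C D ≋ block A′ B′ C′ D′
  block-cong {A = A} {B = B} {C = C} {D = D} a b c d = block-intro
    (λ i j → trans (reflexive (block₁₁ A B C D i j)) (a i j))
    (λ i j → trans (reflexive (block₁₂ A B C D i j)) (b i j))
    (λ i j → trans (reflexive (block₂₁ A B C D i j)) (c i j))
    (λ i j → trans (reflexive (block₂₂ A B C D i j)) (d i j))

  infixl 6 _⊕_
  _⊕_ : ∀ {m n} → Rows m n → Rows m n → Rows m n
  (A ⊕ B) i j = A i j + B i j

  block-⊗ : ∀ {m n m′ n′ m″ n″}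
    (A : Rows m m′) (B : Rows m n′) (C : Rows n m′) (D : Rows n n′)
    (A′ : Rows m′ m″) (B′ : Rows m′ n″) (C′ : Rows n′ m″) (D′ : Rows n′ n″) →
    block A B C D ⊗ block A′ B′ C′ D′ ≋
    block (A ⊗ A′ ⊕ B ⊗ C′) (A ⊗ B′ ⊕ B ⊗ D′) (C ⊗ A′ ⊕ D ⊗ C′) (C ⊗ B′ ⊕ D ⊗ D′)
  block-⊗ {m} {n} {m′} {n′} {m″} {n″} A B C D A′ B′ C′ D′ = block-intro
    (λ i k → entry (L (i ↑ˡ n)) (λ j → R j (k ↑ˡ n″)) (block₁₁ A B C D i) (block₁₂ A B C D i)
               (λ j → block₁₁ A′ B′ C′ D′ j k) (λ j → block₂₁ A′ B′ C′ D′ j k))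
    (λ i k → entry (L (i ↑ˡ n)) (λ j → R j (m″ ↑ʳ k)) (block₁₁ A B C D i) (block₁₂ A B C D i)
               (λ j → block₁₂ A′ B′ C′ D′ j k) (λ j → block₂₂ A′ B′ C′ D′ j k))
    (λ i k → entry (L (m ↑ʳ i)) (λ j → R j (k ↑ˡ n″)) (block₂₁ A B C D i) (block₂₂ A B C D i)
               (λ j → block₁₁ A′ B′ C′ D′ j k) (λ j → block₂₁ A′ B′ C′ D′ j k))
    (λ i k → entry (L (m ↑ʳ i)) (λ j → R j (m″ ↑ʳ k)) (block₂₁ A B C D i) (block₂₂ A B C D i)
               (λ j → block₁₂ A′ B′ C′ D′ j k) (λ j → block₂₂ A′ B′ C′ D′ j k))
    where
    L = block A B C D
    R = block A′ B′ C′ D′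
    entry : ∀ (u v : Vector Carrier (m′ ℕ.+ n′))
      {a a′ : Vector Carrier m′} {b b′ : Vector Carrier n′} →
      (∀ j → u (j ↑ˡ n′) ≡ a j) → (∀ j → u (m′ ↑ʳ j) ≡ b j) →
      (∀ j → v (j ↑ˡ n′) ≡ a′ j) → (∀ j → v (m′ ↑ʳ j) ≡ b′ j) →
      sum (λ j → u j * v j) ≈ sum (λ j → a j * a′ j) + sum (λ j → b j * b′ j)
    entry u v ua ub va vb = trans (sum-split m′ λ j → u j * v j)
      (+-cong (sum-cong λ j → reflexive (≡.cong₂ _*_ (ua j) (va j)))
              (sum-cong λ j → reflexive (≡.cong₂ _*_ (ub j) (vb j))))

  det-zero-column : ∀ {n} (A : Rows (suc n) (suc n)) → (∀ i → A i zero ≈ 0#) → det A ≈ 0#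
  det-zero-column A A₀≈0 = sum-zero {f = λ j → sign j * (A zero j * det (minor A j))} λ
    { zero    → trans (*-congˡ (trans (*-congʳ (A₀≈0 zero)) (zeroˡ _))) (zeroʳ _)
    ; (suc j) → trans (*-congˡ (minor-zero A A₀≈0 j)) (zeroʳ _)
    }
    where
    minor-zero : ∀ {n} (A : Rows (suc n) (suc n)) → (∀ i → A i zero ≈ 0#) → ∀ j →
                 A zero (suc j) * det (minor A (suc j)) ≈ 0#
    minor-zero {suc n} A A₀≈0 j =
      trans (*-congˡ (det-zero-column (minor A (suc j)) λ i → A₀≈0 (suc i))) (zeroʳ _)

  -- The expansion runs along the top row, so the zeros are used through the minors: deleting any
  -- column but the first keeps a first column that is now entirely zero.
  det-first-column : ∀ {n} (A : Rows (suc n) (suc n)) → (∀ i → A (suc i) zero ≈ 0#) →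
                     det A ≈ A zero zero * det (minor A zero)
  det-first-column {n} A A₀≈0 = trans
    (+-cong (*-identityˡ _) (sum-zero λ j → trans (*-congˡ (others A A₀≈0 j)) (zeroʳ _)))
    (+-identityʳ _)
    where
    others : ∀ {n} (A : Rows (suc n) (suc n)) → (∀ i → A (suc i) zero ≈ 0#) → ∀ j →
             A zero (suc j) * det (minor A (suc j)) ≈ 0#
    others {suc n} A A₀≈0 j =
      trans (*-congˡ (det-zero-column (minor A (suc j)) A₀≈0)) (zeroʳ _)

  det-scalar : ∀ n z → det {n} (scalar z) ≈ z ^ n
  det-scalar zero    z = refl
  det-scalar (suc n) z =
    trans (det-first-column (scalar {suc n} z) λ _ → refl) (*-congˡ (det-scalar n z))

  -- The first column has the single entry `z` at the top, so `det-first-column` shrinks the scalar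
  -- corner by one.
  det-block-upper : ∀ n {b} z (X : Rows n b) D →
                    det (block (scalar z) X 𝟎 D) ≈ z ^ n * det D
  det-block-upper zero    z X D = sym (*-identityˡ _)
  det-block-upper (suc n) {b} z X D = begin
    det M
      ≈⟨ det-first-column M (↑-elim n _
           (λ i → reflexive (block₁₁ (scalar z) X 𝟎 D (suc i) zero))
           (λ i → reflexive (block₂₁ (scalar z) X 𝟎 D i zero))) ⟩
    z * det (minor M zero)
      ≈⟨ *-congˡ (det-cong (block-intro
           (λ i j → reflexive (block₁₁ (scalar z) X 𝟎 D (suc i) (suc j)))
           (λ i j → reflexive (block₁₂ (scalar z) X 𝟎 D (suc i) j))
           (λ i j → reflexive (block₂₁ (scalar z) X 𝟎 D i (suc j)))
           (λ i j → reflexive (block₂₂ (scalar z) X 𝟎 D i j)))) ⟩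
    z * det (block (scalar z) (tail X) 𝟎 D)
      ≈⟨ *-congˡ (det-block-upper n z (tail X) D) ⟩
    z * (z ^ n * det D)
      ≈⟨ *-assoc _ _ _ ⟨
    z * z ^ n * det D ∎
    where M = block (scalar z) X 𝟎 D

  punchIn-↑ˡ : ∀ {m} n (j : Fin (suc m)) s → punchIn (j ↑ˡ n) (s ↑ˡ n) ≡ punchIn j s ↑ˡ n
  punchIn-↑ˡ n zero    s       = ≡.refl
  punchIn-↑ˡ n (suc j) zero    = ≡.refl
  punchIn-↑ˡ n (suc j) (suc s) = ≡.cong suc (punchIn-↑ˡ n j s)

  punchIn-↑ʳ : ∀ {m n} (j : Fin (suc m)) (s : Fin n) → punchIn (j ↑ˡ n) (m ↑ʳ s) ≡ suc m ↑ʳ s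
  punchIn-↑ʳ         zero    s = ≡.refl
  punchIn-↑ʳ {suc m} (suc j) s = ≡.cong suc (punchIn-↑ʳ j s)

  -- Here the zero block lies in the top rows: its columns contribute nothing to the expansion, and
  -- the minors at the other columns have the same block shape.
  det-block-lower : ∀ {m n} (A : Rows m m) C (D : Rows n n) →
                    det (block A 𝟎 C D) ≈ det A * det D
  det-block-lower {zero}      A C D = sym (*-identityˡ _)
  det-block-lower {suc m} {n} A C D = begin
    det M
      ≈⟨ sum-split (suc m) (λ j → sign j * (M zero j * det (minor M j))) ⟩
    sum (λ j → sign (j ↑ˡ n) * (M zero (j ↑ˡ n) * det (minor M (j ↑ˡ n)))) +
    sum (λ j → sign (suc m ↑ʳ j) * (M zero (suc m ↑ʳ j) * det (minor M (suc m ↑ʳ j))))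
      ≈⟨ +-cong (sum-cong left) (sum-zero λ j → trans (*-congˡ (trans (*-congʳ
           (reflexive (block₁₂ A 𝟎 C D zero j))) (zeroˡ _))) (zeroʳ _)) ⟩
    sum (λ j → sign j * (A zero j * det (minor A j)) * det D) + 0#
      ≈⟨ +-identityʳ _ ⟩
    sum (λ j → sign j * (A zero j * det (minor A j)) * det D)
      ≈⟨ sum-cong (λ j → *-comm (sign j * (A zero j * det (minor A j))) (det D)) ⟩
    sum (λ j → det D * (sign j * (A zero j * det (minor A j))))
      ≈⟨ sum-*ˡ (det D) (λ j → sign j * (A zero j * det (minor A j))) ⟩
    det D * det A
      ≈⟨ *-comm _ _ ⟩
    det A * det D ∎
    where
    M = block A 𝟎 C D
    minor-block : ∀ j → minor M (j ↑ˡ n) ≋ block (minor A j) 𝟎 (λ r s → C r (punchIn j s)) D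
    minor-block j = block-intro
      (λ r s → reflexive (≡.trans (≡.cong (M (suc r ↑ˡ n)) (punchIn-↑ˡ n j s))
                            (block₁₁ A 𝟎 C D (suc r) (punchIn j s))))
      (λ r s → reflexive (≡.trans (≡.cong (M (suc r ↑ˡ n)) (punchIn-↑ʳ j s))
                            (block₁₂ A 𝟎 C D (suc r) s)))
      (λ r s → reflexive (≡.trans (≡.cong (M (suc m ↑ʳ r)) (punchIn-↑ˡ n j s))
                            (block₂₁ A 𝟎 C D r (punchIn j s))))
      (λ r s → reflexive (≡.trans (≡.cong (M (suc m ↑ʳ r)) (punchIn-↑ʳ j s))
                            (block₂₂ A 𝟎 C D r s)))
    left : ∀ j → sign (j ↑ˡ n) * (M zero (j ↑ˡ n) * det (minor M (j ↑ˡ n)))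
               ≈ sign j * (A zero j * det (minor A j)) * det D
    left j = begin
      sign (j ↑ˡ n) * (M zero (j ↑ˡ n) * det (minor M (j ↑ˡ n)))
        ≈⟨ *-cong (reflexive (≡.cong ((- 1#) ^_) (Fin.toℕ-↑ˡ j n)))
             (*-cong (reflexive (block₁₁ A 𝟎 C D zero j))
               (trans (det-cong (minor-block j)) (det-block-lower (minor A j) _ D))) ⟩
      sign j * (A zero j * (det (minor A j) * det D))
        ≈⟨ solve 4 (λ s a d e → s :* (a :* (d :* e)) := s :* (a :* d) :* e) refl
             (sign j) (A zero j) (det (minor A j)) (det D) ⟩
      sign j * (A zero j * det (minor A j)) * det D ∎

  ⊖_ : ∀ {m n} → Rows m n → Rows m n
  (⊖ A) i j = - A i j

  neg-⊗ˡ : ∀ {l m n} (A : Rows l m) (B : Rows m n) → (⊖ A) ⊗ B ≋ ⊖ (A ⊗ B)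
  neg-⊗ˡ A B i j = begin
    sum (λ k → - A i k * B k j)
      ≈⟨ sum-cong (λ k → trans (sym (-‿distribˡ-* (A i k) (B k j))) (sym (-1*x≈-x _))) ⟩
    sum (λ k → - 1# * (A i k * B k j))
      ≈⟨ trans (sum-*ˡ (- 1#) (λ k → A i k * B k j)) (-1*x≈-x _) ⟩
    - (A ⊗ B) i j ∎

  1^ : ∀ n → 1# ^ n ≈ 1#
  1^ zero    = refl
  1^ (suc n) = trans (*-identityˡ _) (1^ n)

  -- Elimination of an off-diagonal block.

  module _ {a b} (x z : Carrier) (U : Rows a b) (V : Rows b a) where
    private
      T : Rows (a ℕ.+ b) (a ℕ.+ b)
      T = block (scalar x) U V (scalar z)

    -- Left multiplication by `E` clears the upper right block, since `z U - U z = 0`. Scaling the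
    -- top rows by `z` instead of dividing by it keeps the identity valid for every `z`, at the
    -- price of the powers on both sides.
    sylvester-upper : z ^ a * det T ≈ charPoly (U ⊗ V) (x * z) * z ^ b
    sylvester-upper = begin
      z ^ a * det T
        ≈⟨ *-congʳ (trans (det-block-upper a z (⊖ U) (scalar 1#))
             (trans (*-congˡ (trans (det-scalar b 1#) (1^ b))) (*-identityʳ _))) ⟨
      det E * det T
        ≈⟨ det-⊗ E T ⟨
      det (E ⊗ T)
        ≈⟨ det-cong (λ i j → trans
             (block-⊗ (scalar z) (⊖ U) 𝟎 (scalar 1#) (scalar x) U V (scalar z) i j)
             (block-cong e₁₁ e₁₂ e₂₁ e₂₂ i j)) ⟩
      det (block (charMatrix (U ⊗ V) (x * z)) 𝟎 V (scalar z))
        ≈⟨ det-block-lower (charMatrix (U ⊗ V) (x * z)) V (scalar z) ⟩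
      charPoly (U ⊗ V) (x * z) * det {b} (scalar z)
        ≈⟨ *-congˡ (det-scalar b z) ⟩
      charPoly (U ⊗ V) (x * z) * z ^ b ∎
      where
      E = block (scalar z) (⊖ U) 𝟎 (scalar 1#)
      e₁₁ : scalar z ⊗ scalar x ⊕ (⊖ U) ⊗ V ≋ charMatrix (U ⊗ V) (x * z)
      e₁₁ i j = +-cong
        (trans (sum-scalarˡ z i λ k → scalar x k j) (trans (scalar-* z x i j)
          (scalar-cong (*-comm z x) i j)))
        (neg-⊗ˡ U V i j)
      e₁₂ : scalar z ⊗ U ⊕ (⊖ U) ⊗ scalar z ≋ 𝟎
      e₁₂ i j = trans (+-cong (sum-scalarˡ z i λ k → U k j) (sum-scalarʳ z j λ k → - U i k))
        (trans (+-cong (*-comm _ _) (sym (-‿distribˡ-* _ _))) (-‿inverseʳ _))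
      e₂₁ : 𝟎 ⊗ scalar x ⊕ scalar 1# ⊗ V ≋ V
      e₂₁ i j = trans (+-cong (sum-zero λ k → zeroˡ (scalar x k j))
        (trans (sum-scalarˡ 1# i λ k → V k j) (*-identityˡ _))) (+-identityˡ _)
      e₂₂ : 𝟎 ⊗ U ⊕ scalar 1# ⊗ scalar z ≋ scalar z
      e₂₂ i j = trans (+-cong (sum-zero λ k → zeroˡ (U k j))
        (trans (sum-scalarˡ 1# i λ k → scalar z k j) (*-identityˡ _))) (+-identityˡ _)

    -- The same with the lower left block cleared, scaling the bottom rows by `x`.
    sylvester-lower : x ^ b * det T ≈ x ^ a * charPoly (V ⊗ U) (x * z)
    sylvester-lower = begin
      x ^ b * det T
        ≈⟨ *-congʳ (trans (det-block-lower (scalar 1#) (⊖ V) (scalar x))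
             (trans (*-cong (trans (det-scalar a 1#) (1^ a)) (det-scalar b x)) (*-identityˡ _))) ⟨
      det E * det T
        ≈⟨ det-⊗ E T ⟨
      det (E ⊗ T)
        ≈⟨ det-cong (λ i j → trans
             (block-⊗ (scalar 1#) 𝟎 (⊖ V) (scalar x) (scalar x) U V (scalar z) i j)
             (block-cong e₁₁ e₁₂ e₂₁ e₂₂ i j)) ⟩
      det (block (scalar x) U 𝟎 (charMatrix (V ⊗ U) (x * z)))
        ≈⟨ det-block-upper a x U (charMatrix (V ⊗ U) (x * z)) ⟩
      x ^ a * charPoly (V ⊗ U) (x * z) ∎
      where
      E = block (scalar 1#) 𝟎 (⊖ V) (scalar x)
      e₁₁ : scalar 1# ⊗ scalar x ⊕ 𝟎 ⊗ V ≋ scalar x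
      e₁₁ i j = trans (+-cong (trans (sum-scalarˡ 1# i λ k → scalar x k j) (*-identityˡ _))
        (sum-zero λ k → zeroˡ (V k j))) (+-identityʳ _)
      e₁₂ : scalar 1# ⊗ U ⊕ 𝟎 ⊗ scalar z ≋ U
      e₁₂ i j = trans (+-cong (trans (sum-scalarˡ 1# i λ k → U k j) (*-identityˡ _))
        (sum-zero λ k → zeroˡ (scalar z k j))) (+-identityʳ _)
      e₂₁ : (⊖ V) ⊗ scalar x ⊕ scalar x ⊗ V ≋ 𝟎
      e₂₁ i j = trans (+-cong (sum-scalarʳ x j λ k → - V i k) (sum-scalarˡ x i λ k → V k j))
        (trans (+-cong (sym (-‿distribˡ-* _ _)) (*-comm _ _)) (-‿inverseˡ _))
      e₂₂ : (⊖ V) ⊗ U ⊕ scalar x ⊗ scalar z ≋ charMatrix (V ⊗ U) (x * z)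
      e₂₂ i j = trans (+-comm _ _) (+-cong
        (trans (sum-scalarˡ x i λ k → scalar z k j) (scalar-* x z i j))
        (neg-⊗ˡ V U i j))

-- Order and apartness in the field of scalars.

module OrderedField {c ℓ₁ ℓ₂} (F : EuclideanField c ℓ₁ ℓ₂) where
  open EuclideanField F
    using (commutativeRing; heytingField; _#_; _<_; _≤_; isStrictPartialOrder; #⇒<⊎>; <⇒#;
           +-monoˡ-<; *-pos; #-sym; #-cotrans; #⇒invertible; tight)
  open IsStrictPartialOrder isStrictPartialOrder
    using (<-respʳ-≈; <-respˡ-≈; irrefl) renaming (trans to <-trans)
  open CommutativeRing commutativeRing hiding (zero)
  open Spectral F using (_·_; _^_)
  open RingProperties ring
  open ApartnessProperties (HeytingField.heytingCommutativeRing heytingField)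
    using (1#0; x#0y#0→xy#0; x-0≈x)
  open SetoidReasoning setoid

  ¬#⇒≈ : ∀ {x y} → ¬ (x # y) → x ≈ y
  ¬#⇒≈ {x} {y} = proj₁ (tight x y)

  1>0 : 0# < 1#
  1>0 with #⇒<⊎> 1#0
  ... | inj₂ 0<1 = 0<1
  ... | inj₁ 1<0 = <-respʳ-≈ (trans (-1*x≈-x _) (-‿involutive 1#)) (*-pos 0<-1 0<-1)
    where
    0<-1 : 0# < - 1#
    0<-1 = <-respˡ-≈ (-‿inverseʳ 1#) (<-respʳ-≈ (+-identityˡ _) (+-monoˡ-< (- 1#) 1<0))

  +-monoʳ-< : ∀ z {x y} → x < y → z + x < z + y
  +-monoʳ-< z x<y = <-respˡ-≈ (+-comm _ z) (<-respʳ-≈ (+-comm _ z) (+-monoˡ-< z x<y))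

  pos+pos : ∀ {x y} → 0# < x → 0# < y → 0# < x + y
  pos+pos {x} {y} 0<x 0<y =
    <-trans 0<x (<-respˡ-≈ (+-identityʳ x) (+-monoʳ-< x 0<y))

  suc·1>0 : ∀ k → 0# < suc k · 1#
  suc·1>0 zero    = <-respʳ-≈ (sym (+-identityʳ 1#)) 1>0
  suc·1>0 (suc k) = pos+pos 1>0 (suc·1>0 k)

  suc·1#0 : ∀ k → (suc k · 1#) # 0#
  suc·1#0 k = #-sym (<⇒# (suc·1>0 k))

  -- The signs of `x` and `y` cannot be decided, but if `x + y < 0` then cotransitivity makes `x`
  -- apart from `x + y` or from `0#`, and each resulting comparison forces `x` or `y` to be
  -- negative.
  nonneg+nonneg : ∀ {x y} → 0# ≤ x → 0# ≤ y → 0# ≤ x + y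
  nonneg+nonneg {x} {y} 0≤x 0≤y x+y<0 with #-cotrans (<⇒# x+y<0) x
  ... | inj₁ x+y#x = 0≤y (y<0 (#⇒<⊎> x+y#x))
    where
    cancel : ∀ {z} → - x + (x + z) ≈ z
    cancel = trans (sym (+-assoc _ _ _)) (trans (+-congʳ (-‿inverseˡ x)) (+-identityˡ _))
    y<0 : (x + y) < x ⊎ x < (x + y) → y < 0#
    y<0 (inj₁ x+y<x) = <-respˡ-≈ cancel (<-respʳ-≈ (-‿inverseˡ x) (+-monoʳ-< (- x) x+y<x))
    y<0 (inj₂ x<x+y) = contradiction (<-trans x<x+y x+y<0) 0≤x
  ... | inj₂ x#0 with #⇒<⊎> x#0
  ...   | inj₁ x<0 = 0≤x x<0
  ...   | inj₂ 0<x = 0≤y (<-trans (<-respˡ-≈ (+-identityˡ y) (+-monoˡ-< y 0<x)) x+y<0)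

  0≤0 : 0# ≤ 0#
  0≤0 = irrefl refl

  ·-nonneg : ∀ k {x} → 0# ≤ x → 0# ≤ k · x
  ·-nonneg zero    0≤x = 0≤0
  ·-nonneg (suc k) 0≤x = nonneg+nonneg 0≤x (·-nonneg k 0≤x)

  -- Carries apartness from `0#` from the least eigenvalue to all others. Cotransitivity compares
  -- `y` with the two ends of `x # 0#`.
  #0-upward : ∀ {x y} → 0# ≤ x → x ≤ y → x # 0# → y # 0#
  #0-upward {x} {y} 0≤x x≤y x#0 with #-cotrans x#0 y
  ... | inj₂ y#0 = y#0
  ... | inj₁ x#y with #⇒<⊎> x#y | #⇒<⊎> x#0
  ...   | inj₂ y<x | _        = contradiction y<x x≤y
  ...   | inj₁ _   | inj₁ x<0 = contradiction x<0 0≤x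
  ...   | inj₁ x<y | inj₂ 0<x = #-sym (<⇒# (<-trans 0<x x<y))

  neg-#0 : ∀ {x} → x # 0# → (0# - x) # 0#
  neg-#0 {x} x#0 with #⇒<⊎> x#0
  ... | inj₁ x<0 = #-sym (<⇒# (<-respˡ-≈ (-‿inverseʳ x) (+-monoˡ-< (- x) x<0)))
  ... | inj₂ 0<x = <⇒# (<-respʳ-≈ (-‿inverseʳ x) (+-monoˡ-< (- x) 0<x))

  #0⇒inverse : ∀ {x} → x # 0# → ∃ λ x⁻¹ → x * x⁻¹ ≈ 1#
  #0⇒inverse {x} x#0 with #⇒invertible x#0
  ... | x⁻¹ , _ , inverse = x⁻¹ , trans (*-congʳ (sym (x-0≈x x))) inverse

  *-cancelˡ-#0 : ∀ {x y z} → x # 0# → x * y ≈ x * z → y ≈ z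
  *-cancelˡ-#0 {x} {y} {z} x#0 xy≈xz with #0⇒inverse x#0
  ... | x⁻¹ , xx⁻¹≈1 = trans (sym (undo y)) (trans (*-congˡ xy≈xz) (undo z))
    where
    undo : ∀ w → x⁻¹ * (x * w) ≈ w
    undo w = trans (sym (*-assoc _ _ _)) (trans (*-congʳ (trans (*-comm _ _) xx⁻¹≈1)) (*-identityˡ w))

  ^-#0 : ∀ {x} k → x # 0# → (x ^ k) # 0#
  ^-#0 zero    x#0 = 1#0
  ^-#0 (suc k) x#0 = x#0y#0→xy#0 x#0 (^-#0 k x#0)

-- Products of linear factors, and scaling and duplication of matrices.

module CharPoly {c ℓ₁ ℓ₂} (F : EuclideanField c ℓ₁ ℓ₂) where
  open EuclideanField F using (commutativeRing; _≤_; √; √-square)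
  open CommutativeRing commutativeRing hiding (zero)
  open Spectral F
  open Determinant F
  open OrderedField F
  open RingProperties ring
  open MultProperties +-commutativeMonoid using (×-congʳ; ×-distrib-+; ×-assocˡ)
  open SemiringMultProperties semiring using (×-assoc-*)
  open SemiringSolver commutativeSemiring using (solve; _:=_; _:*_)
  open SetoidReasoning setoid

  -- By definition the right-hand side of `IsSpectrum`.
  linearProduct : List Carrier → Carrier → Carrier
  linearProduct λs x = List.foldr _*_ 1# (List.map (λ y → x - y) λs)

  linearProduct-++ : ∀ κs λs x → linearProduct (κs ++ λs) x ≈ linearProduct κs x * linearProduct λs x
  linearProduct-++ []       λs x = sym (*-identityˡ _)
  linearProduct-++ (y ∷ κs) λs x = trans (*-congˡ (linearProduct-++ κs λs x)) (sym (*-assoc _ _ _))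

  linearProduct-cong : ∀ λs {x y} → x ≈ y → linearProduct λs x ≈ linearProduct λs y
  linearProduct-cong []       x≈y = refl
  linearProduct-cong (_ ∷ λs) x≈y = *-cong (+-congʳ x≈y) (linearProduct-cong λs x≈y)

  linearProduct-zeros : ∀ k x → linearProduct (replicate k 0#) x ≈ x ^ k
  linearProduct-zeros zero    x = refl
  linearProduct-zeros (suc k) x =
    *-cong (trans (+-congˡ -0#≈0#) (+-identityʳ x)) (linearProduct-zeros k x)

  difference-of-squares : ∀ x s → (x - s) * (x - - s) ≈ x * x - s * s
  difference-of-squares x s = begin
    (x - s) * (x - - s)                      ≈⟨ *-congˡ (+-congˡ (-‿involutive s)) ⟩
    (x - s) * (x + s)                        ≈⟨ distribʳ _ x (- s) ⟩
    x * (x + s) + - s * (x + s)              ≈⟨ +-cong (distribˡ x x s) (distribˡ (- s) x s) ⟩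
    x * x + x * s + (- s * x + - s * s)      ≈⟨ +-congˡ (+-cong
      (trans (sym (-‿distribˡ-* s x)) (-‿cong (*-comm s x))) (sym (-‿distribˡ-* s s))) ⟩
    x * x + x * s + (- (x * s) - s * s)      ≈⟨ +-assoc _ _ _ ⟩
    x * x + (x * s + (- (x * s) - s * s))    ≈⟨ +-congˡ (+-assoc _ _ _) ⟨
    x * x + (x * s - x * s - s * s)          ≈⟨ +-congˡ (trans (+-congʳ (-‿inverseʳ _)) (+-identityˡ _)) ⟩
    x * x - s * s                            ∎

  -- Each pair of roots contributes `x * x - a · y`; nonnegativity of `y` is what gives the square
  -- of `√ (a · y)` its value.
  linearProduct-±√ : ∀ a {λs} → All (0# ≤_) λs → ∀ x →
    linearProduct (±√ a λs) x ≈ linearProduct (List.map (a ·_) λs) (x * x)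
  linearProduct-±√ a []                  x = refl
  linearProduct-±√ a (_∷_ {y} 0≤y 0≤λs) x = trans (sym (*-assoc _ _ _)) (*-cong
    (trans (difference-of-squares x (√ (a · y))) (+-congˡ (-‿cong (√-square (·-nonneg a 0≤y)))))
    (linearProduct-±√ a 0≤λs x))

  linearProduct-scale : ∀ a λs x →
    (a · 1#) ^ length λs * linearProduct λs x ≈ linearProduct (List.map (a ·_) λs) ((a · 1#) * x)
  linearProduct-scale a []       x = *-identityˡ _
  linearProduct-scale a (y ∷ λs) x = begin
    d * d ^ length λs * ((x - y) * linearProduct λs x)
      ≈⟨ solve 4 (λ d e u v → d :* e :* (u :* v) := (d :* u) :* (e :* v)) refl
           d (d ^ length λs) (x - y) (linearProduct λs x) ⟩
    d * (x - y) * (d ^ length λs * linearProduct λs x)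
      ≈⟨ *-cong (trans (distribˡ d x (- y)) (+-congˡ (trans (sym (-‿distribʳ-* d y)) (-‿cong d*y≈a·y))))
                (linearProduct-scale a λs x) ⟩
    (d * x - a · y) * linearProduct (List.map (a ·_) λs) (d * x) ∎
    where
    d = a · 1#
    d*y≈a·y : d * y ≈ a · y
    d*y≈a·y = trans (×-assoc-* a 1# y) (×-congʳ a (*-identityˡ y))

  charPoly-cong : ∀ {n} {A B : Rows n n} {x y} → A ≋ B → x ≈ y → charPoly A x ≈ charPoly B y
  charPoly-cong A≋B x≈y = det-cong λ i j → +-cong (scalar-cong x≈y i j) (-‿cong (A≋B i j))

  infixr 8 _·ᴹ_
  _·ᴹ_ : ∀ {m n} → ℕ → Rows m n → Rows m n
  (a ·ᴹ A) i j = a · A i j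

  charPoly-scale : ∀ {n} a (A : Rows n n) x →
    charPoly (a ·ᴹ A) ((a · 1#) * x) ≈ (a · 1#) ^ n * charPoly A x
  charPoly-scale {n} a A x = begin
    det (charMatrix (a ·ᴹ A) (d * x))  ≈⟨ det-cong entry ⟨
    det (scalar d ⊗ charMatrix A x)    ≈⟨ det-⊗ (scalar d) (charMatrix A x) ⟩
    det {n} (scalar d) * charPoly A x  ≈⟨ *-congʳ (det-scalar n d) ⟩
    d ^ n * charPoly A x               ∎
    where
    d = a · 1#
    entry : scalar d ⊗ charMatrix A x ≋ charMatrix (a ·ᴹ A) (d * x)
    entry i j = begin
      sum (λ k → scalar d i k * charMatrix A x k j)
        ≈⟨ sum-scalarˡ d i (λ k → charMatrix A x k j) ⟩
      d * (scalar x i j - A i j)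
        ≈⟨ distribˡ d _ _ ⟩
      d * scalar x i j + d * - A i j
        ≈⟨ +-cong (scalar-* d x i j) (trans (sym (-‿distribʳ-* d _))
             (-‿cong (trans (×-assoc-* a 1# _) (×-congʳ a (*-identityˡ _))))) ⟩
      scalar (d * x) i j - a · A i j ∎

  -- The given spectrum is evaluated at `d⁻¹ * y`, and the factors `d ^ n` from both scalings agree.
  -- The multiplier has the form `suc a` so that `d` is positive, hence invertible.
  charPoly-multiple : ∀ {n} a (A : Rows n n) (μ : Vector Carrier n) → IsSpectrum A (tabulate μ) →
    ∀ y → charPoly (suc a ·ᴹ A) y ≈ linearProduct (List.map (suc a ·_) (tabulate μ)) y
  charPoly-multiple {n} a A μ spectrum y with #0⇒inverse (suc·1#0 a)
  ... | d⁻¹ , dd⁻¹≈1 = begin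
    charPoly (suc a ·ᴹ A) y
      ≈⟨ charPoly-cong {A = suc a ·ᴹ A} (λ _ _ → refl) y≈ ⟩
    charPoly (suc a ·ᴹ A) (d * (d⁻¹ * y))
      ≈⟨ charPoly-scale (suc a) A (d⁻¹ * y) ⟩
    d ^ n * charPoly A (d⁻¹ * y)
      ≈⟨ *-congˡ (spectrum (d⁻¹ * y)) ⟩
    d ^ n * linearProduct (tabulate μ) (d⁻¹ * y)
      ≡⟨ ≡.cong (λ k → d ^ k * linearProduct (tabulate μ) (d⁻¹ * y)) (List.length-tabulate μ) ⟨
    d ^ length (tabulate μ) * linearProduct (tabulate μ) (d⁻¹ * y)
      ≈⟨ linearProduct-scale (suc a) (tabulate μ) (d⁻¹ * y) ⟩
    linearProduct (List.map (suc a ·_) (tabulate μ)) (d * (d⁻¹ * y))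
      ≈⟨ linearProduct-cong (List.map (suc a ·_) (tabulate μ)) y≈ ⟨
    linearProduct (List.map (suc a ·_) (tabulate μ)) y ∎
    where
    d = suc a · 1#
    y≈ : y ≈ d * (d⁻¹ * y)
    y≈ = sym (trans (sym (*-assoc _ _ _)) (trans (*-congʳ dd⁻¹≈1) (*-identityˡ y)))

  quotient-↑ˡ : ∀ {m} k (i : Fin k) → quotient {suc m} k (i ↑ˡ (m ℕ.* k)) ≡ zero
  quotient-↑ˡ {m} k i rewrite Fin.splitAt-↑ˡ k i (m ℕ.* k) = ≡.refl

  quotient-↑ʳ : ∀ {m} k (j : Fin (m ℕ.* k)) → quotient {suc m} k (k ↑ʳ j) ≡ suc (quotient k j)
  quotient-↑ʳ {m} k j rewrite Fin.splitAt-↑ʳ k (m ℕ.* k) j = ≡.refl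

  sum-const : ∀ k x → sum {k} (λ _ → x) ≈ k · x
  sum-const zero    x = refl
  sum-const (suc k) x = +-congˡ (sum-const k x)

  sum-quotient : ∀ {m} k (g : Vector Carrier m) → sum (λ i → g (quotient k i)) ≈ k · sum g
  sum-quotient {zero}  k g = sym (trans (sym (sum-const k 0#)) (sum-zero {k} λ _ → refl))
  sum-quotient {suc m} k g = begin
    sum (λ i → g (quotient k i))
      ≈⟨ sum-split k (λ i → g (quotient k i)) ⟩
    sum (λ i → g (quotient k (i ↑ˡ (m ℕ.* k)))) + sum (λ j → g (quotient k (k ↑ʳ j)))
      ≈⟨ +-cong (sum-cong λ i → reflexive (≡.cong g (quotient-↑ˡ {m} k i)))
                (sum-cong λ j → reflexive (≡.cong g (quotient-↑ʳ k j))) ⟩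
    sum {k} (λ _ → g zero) + sum (λ j → g (suc (quotient k j)))
      ≈⟨ +-cong (sum-const k (g zero)) (sum-quotient k (g ∘ suc)) ⟩
    k · g zero + k · sum (g ∘ suc)
      ≈⟨ ×-distrib-+ (g zero) (sum (g ∘ suc)) k ⟨
    k · sum g ∎

  -- The duplicated matrix factors as P ⊗ X, while X ⊗ P is a multiple of L.
  duplication : ∀ {n} p k (L : Rows n n) y →
    y ^ (n ℕ.* p) * charPoly ((p ℕ.* k) ·ᴹ L) y ≈
    y ^ n * charPoly (λ i i′ → k · L (quotient p i) (quotient p i′)) y
  -- Both elimination identities are taken with `z` equal to `1#`: its powers disappear and the
  -- characteristic polynomials are evaluated at `y` itself.
  duplication {n} p k L y = begin
    y ^ a * charPoly ((p ℕ.* k) ·ᴹ L) y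
      ≈⟨ *-congˡ (charPoly-cong X⊗P (*-identityʳ y)) ⟨
    y ^ a * charPoly (X ⊗ P) (y * 1#)
      ≈⟨ *-congˡ (trans (*-congˡ (1^ a)) (*-identityʳ _)) ⟨
    y ^ a * (charPoly (X ⊗ P) (y * 1#) * 1# ^ a)
      ≈⟨ *-congˡ (sylvester-upper y 1# X P) ⟨
    y ^ a * (1# ^ n * det (block (scalar y) X P (scalar 1#)))
      ≈⟨ *-congˡ (trans (*-congʳ (1^ n)) (*-identityˡ _)) ⟩
    y ^ a * det (block (scalar y) X P (scalar 1#))
      ≈⟨ sylvester-lower y 1# X P ⟩
    y ^ n * charPoly (P ⊗ X) (y * 1#)
      ≈⟨ *-congˡ (charPoly-cong P⊗X (*-identityʳ y)) ⟩
    y ^ n * charPoly (λ i i′ → k · L (quotient p i) (quotient p i′)) y ∎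
    where
    a = n ℕ.* p
    X : Rows n a
    X v i = k · L v (quotient p i)
    P : Rows a n
    P i v = scalar 1# (quotient p i) v
    P⊗X : P ⊗ X ≋ λ i i′ → k · L (quotient p i) (quotient p i′)
    P⊗X i i′ = trans (sum-scalarˡ 1# (quotient p i) λ v → X v i′) (*-identityˡ _)
    X⊗P : X ⊗ P ≋ (p ℕ.* k) ·ᴹ L
    X⊗P v w = begin
      sum (λ i → (k · L v (quotient p i)) * scalar 1# (quotient p i) w)
        ≈⟨ sum-quotient p (λ u → (k · L v u) * scalar 1# u w) ⟩
      p · sum (λ u → (k · L v u) * scalar 1# u w)
        ≈⟨ ×-congʳ p (trans (sum-scalarʳ 1# w λ u → k · L v u) (*-identityʳ _)) ⟩
      p · (k · L v w)
        ≈⟨ ×-assocˡ (L v w) p k ⟩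
      (p ℕ.* k) · L v w ∎

  -- `E` is the identity matrix with `w` as its top row: its determinant is `w zero`, while `E ⊗ M`
  -- has a zero top row.
  det-singular : ∀ {n} (M : Rows (suc n) (suc n)) w {w₀⁻¹} → w₀⁻¹ * w zero ≈ 1# →
                 (∀ v → sum (λ u → w u * M u v) ≈ 0#) → det M ≈ 0#
  det-singular {n} M w {w₀⁻¹} invertible wM≈0 = begin
    det M                      ≈⟨ *-identityˡ _ ⟨
    1# * det M                 ≈⟨ *-congʳ invertible ⟨
    w₀⁻¹ * w zero * det M      ≈⟨ *-congʳ (*-congˡ det-E) ⟨
    w₀⁻¹ * det E * det M       ≈⟨ *-assoc _ _ _ ⟩
    w₀⁻¹ * (det E * det M)     ≈⟨ *-congˡ (det-⊗ E M) ⟨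
    w₀⁻¹ * det (E ⊗ M)         ≈⟨ *-congˡ (sum-zero λ j → trans
      (*-congˡ {sign j} (trans (*-congʳ (wM≈0 j)) (zeroˡ (det (minor (E ⊗ M) j))))) (zeroʳ _)) ⟩
    w₀⁻¹ * 0#                  ≈⟨ zeroʳ _ ⟩
    0#                         ∎
    where
    E : Rows (suc n) (suc n)
    E zero    = w
    E (suc i) = scalar 1# (suc i)
    det-E : det E ≈ w zero
    det-E = trans (det-first-column E λ _ → refl)
      (trans (*-congˡ (trans (det-scalar n 1#) (1^ n))) (*-identityʳ _))

-- The signed incidence matrix and its Gram matrix.

module Incidence {c ℓ₁ ℓ₂} (F : EuclideanField c ℓ₁ ℓ₂)
  {n m} (Γ : SignedGraph (Fin n)) (e : Fin m ↔ Edge Γ) where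
  open EuclideanField F using (commutativeRing)
  open CommutativeRing commutativeRing hiding (zero)
  open Spectral F
  open Determinant F
  open RingProperties ring
  open SetoidReasoning setoid
  open SignedGraph Γ

  indicator : ∀ {p} {P : Set p} → Dec P → Carrier
  indicator P? = if does P? then 1# else 0#

  module _ {p} {P : Set p} (P? : Dec P) where
    indicator-yes : P → indicator P? ≡ 1#
    indicator-yes x = ≡.cong (if_then 1# else 0#) (dec-true P? x)

    indicator-no : ¬ P → indicator P? ≡ 0#
    indicator-no ¬x = ≡.cong (if_then 1# else 0#) (dec-false P? ¬x)

  sum-indicator-none : ∀ {k p} {P : Pred (Fin k) p} (P? : Decidable P) → (∀ i → ¬ P i) →
                       sum (λ i → indicator (P? i)) ≈ 0#
  sum-indicator-none P? ¬P = sum-zero λ i → reflexive (indicator-no (P? i) (¬P i))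

  sum-indicator-unique : ∀ {k p} {P : Pred (Fin k) p} (P? : Decidable P) i₀ →
    P i₀ → (∀ i → P i → i₀ ≡ i) → sum (λ i → indicator (P? i)) ≈ 1#
  sum-indicator-unique {P = P} P? i₀ Pi₀ unique = begin
    sum (λ i → indicator (P? i))    ≈⟨ sum-cong (λ i → trans (pointwise i) (sym (*-identityʳ _))) ⟩
    sum (λ i → scalar 1# i₀ i * 1#) ≈⟨ sum-scalarˡ 1# i₀ (λ _ → 1#) ⟩
    1# * 1#                         ≈⟨ *-identityˡ 1# ⟩
    1#                              ∎
    where
    pointwise : ∀ i → indicator (P? i) ≈ scalar 1# i₀ i
    pointwise i with i₀ Fin.≟ i
    ... | yes ≡.refl = reflexive (indicator-yes (P? i) Pi₀)
    ... | no  i₀≢i   = reflexive (indicator-no (P? i) λ Pi → i₀≢i (unique i Pi))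

  -- Stated for `List.tabulate f` so that the induction can pass to `f ∘ suc`. `degree` is the case
  -- where `f` is the identity.
  sum-indicator-count : ∀ {k p} {A : Set} {P : Pred A p} (P? : Decidable P) (f : Fin k → A) →
    sum (λ i → indicator (P? (f i))) ≈ length (filter P? (List.tabulate f)) · 1#
  sum-indicator-count {zero}  P? f = refl
  sum-indicator-count {suc k} P? f with does (P? (f zero))
  ... | true  = +-congˡ (sum-indicator-count P? (f ∘ suc))
  ... | false = trans (+-identityˡ _) (sum-indicator-count P? (f ∘ suc))

  src tgt : Fin m → Fin n
  src = end₁ Γ e
  tgt  = end₂ Γ e

  src<tgt : ∀ j → src j Fin.< tgt j
  src<tgt j = proj₁ (proj₂ (proj₂ (Inverse.to e j)))

  src~tgt : ∀ j → src j ~ tgt j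
  src~tgt j = toWitness (proj₂ (proj₂ (proj₂ (Inverse.to e j))))

  -- The order proof is unique, and so is the adjacency proof because an edge stores it through
  -- `True`. This makes the edge joining two vertices unique even if `_~_` has several proofs.
  edge-≡ : ∀ (x y : Edge Γ) → proj₁ x ≡ proj₁ y → proj₁ (proj₂ x) ≡ proj₁ (proj₂ y) → x ≡ y
  edge-≡ (i , j , i<j , adj) (_ , _ , i<j′ , adj′) ≡.refl ≡.refl =
    ≡.cong₂ (λ p q → i , j , p , q) (ℕ.<-irrelevant i<j i<j′) (T-irrelevant adj adj′)

  Joins : Fin n → Fin n → Fin m → Set
  Joins u v j = (u ≡ src j × v ≡ tgt j) ⊎ (u ≡ tgt j × v ≡ src j)

  joins? : ∀ u v j → Dec (Joins u v j)
  joins? u v j = ((u Fin.≟ src j) ×-dec (v Fin.≟ tgt j)) ⊎-dec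
                 ((u Fin.≟ tgt j) ×-dec (v Fin.≟ src j))

  joins-sym : ∀ {u v j} → Joins u v j → Joins v u j
  joins-sym (inj₁ (p , q)) = inj₂ (q , p)
  joins-sym (inj₂ (p , q)) = inj₁ (q , p)

  joins⇒~ : ∀ {u v j} → Joins u v j → u ~ v
  joins⇒~ {j = j} (inj₁ (≡.refl , ≡.refl)) = src~tgt j
  joins⇒~ {j = j} (inj₂ (≡.refl , ≡.refl)) = ~-sym (src~tgt j)

  joining-edge-< : ∀ {u v} → u Fin.< v → u ~ v → ∃ λ j₀ → Joins u v j₀ × (∀ j → Joins u v j → j₀ ≡ j)
  joining-edge-< {u} {v} u<v u~v =
    j₀ , inj₁ (≡.cong proj₁ (≡.sym to-j₀) , ≡.cong (proj₁ ∘ proj₂) (≡.sym to-j₀)) , unique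
    where
    x : Edge Γ
    x = u , v , u<v , fromWitness u~v
    j₀ = Inverse.from e x
    to-j₀ : Inverse.to e j₀ ≡ x
    to-j₀ = Inverse.strictlyInverseˡ e x
    unique : ∀ j → Joins u v j → j₀ ≡ j
    unique j (inj₁ (p , q)) = ≡.trans (≡.cong (Inverse.from e) (edge-≡ x (Inverse.to e j) p q))
                                      (Inverse.strictlyInverseʳ e j)
    unique j (inj₂ (≡.refl , ≡.refl)) = contradiction (src<tgt j) (ℕ.<-asym u<v)

  joining-edge : ∀ {u v} → u ~ v → ∃ λ j₀ → Joins u v j₀ × (∀ j → Joins u v j → j₀ ≡ j)
  joining-edge {u} {v} u~v with Fin.<-cmp u v
  ... | tri< u<v _ _    = joining-edge-< u<v u~v
  ... | tri≈ _ ≡.refl _ = contradiction u~v ~-irrefl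
  ... | tri> _ _ v<u with joining-edge-< v<u (~-sym u~v)
  ...   | j₀ , joins , unique = j₀ , joins-sym joins , λ j → unique j ∘ joins-sym

  sum-joining-edges : ∀ u v → sum (λ j → indicator (joins? u v j)) ≈ indicator (u ~? v)
  sum-joining-edges u v with u ~? v
  ... | no  u≁v = sum-indicator-none (joins? u v) λ j → u≁v ∘ joins⇒~
  ... | yes u~v with joining-edge u~v
  ...   | j₀ , joins , unique = sum-indicator-unique (joins? u v) j₀ joins unique

  sum-joined-vertices : ∀ u j → sum (λ v → indicator (joins? u v j)) ≈ indicator (incident? Γ e u j)
  sum-joined-vertices u j = by-cases (incident? Γ e u j)
    where
    by-cases : Dec (Incident Γ e u j) →
               sum (λ v → indicator (joins? u v j)) ≈ indicator (incident? Γ e u j)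
    by-cases (yes inc@(inj₁ u≡src)) = trans
      (sum-indicator-unique (λ v → joins? u v j) (tgt j) (inj₁ (u≡src , ≡.refl)) λ
        { v (inj₁ (_ , v≡tgt)) → ≡.sym v≡tgt
        ; v (inj₂ (u≡tgt , _)) →
            contradiction (≡.trans (≡.sym u≡src) u≡tgt) (Fin.<⇒≢ (src<tgt j))
        })
      (reflexive (≡.sym (indicator-yes (incident? Γ e u j) inc)))
    by-cases (yes inc@(inj₂ u≡tgt)) = trans
      (sum-indicator-unique (λ v → joins? u v j) (src j) (inj₂ (u≡tgt , ≡.refl)) λ
        { v (inj₁ (u≡src , _)) →
            contradiction (≡.trans (≡.sym u≡src) u≡tgt) (Fin.<⇒≢ (src<tgt j))
        ; v (inj₂ (_ , v≡src)) → ≡.sym v≡src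
        })
      (reflexive (≡.sym (indicator-yes (incident? Γ e u j) inc)))
    by-cases (no ¬inc) = trans
      (sum-indicator-none (λ v → joins? u v j) λ
        { v (inj₁ (u≡src , _)) → ¬inc (inj₁ u≡src)
        ; v (inj₂ (u≡tgt , _)) → ¬inc (inj₂ u≡tgt)
        })
      (reflexive (≡.sym (indicator-no (incident? Γ e u j) ¬inc)))

  signValue-* : ∀ s t → signValue s * signValue t ≈ signValue (s Sign.* t)
  signValue-* Sign.+ t      = *-identityˡ _
  signValue-* Sign.- Sign.+ = *-identityʳ _
  signValue-* Sign.- Sign.- = trans (-1*x≈-x _) (-‿involutive 1#)

  signValue-square : ∀ s → signValue s * signValue s ≈ 1#
  signValue-square s = trans (signValue-* s s) (reflexive (≡.cong signValue (Sign.s*s≡+ s)))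

  signValue-opposite : ∀ s → signValue (Sign.opposite s) ≈ - signValue s
  signValue-opposite Sign.+ = refl
  signValue-opposite Sign.- = sym (-‿involutive 1#)

  module _ (ϑ : Fin n → Fin m → Sign) where

    incidence : Rows n m
    incidence i j = if does (incident? Γ e i j) then signValue (ϑ i j) else 0#

    incidence-yes : ∀ {i j} → Incident Γ e i j → incidence i j ≡ signValue (ϑ i j)
    incidence-yes {i} {j} inc =
      ≡.cong (if_then signValue (ϑ i j) else 0#) (dec-true (incident? Γ e i j) inc)

    incidence-no : ∀ {i j} → ¬ Incident Γ e i j → incidence i j ≡ 0#
    incidence-no {i} {j} ¬inc =
      ≡.cong (if_then signValue (ϑ i j) else 0#) (dec-false (incident? Γ e i j) ¬inc)

    incidence-square : ∀ u j → incidence u j * incidence u j ≈ indicator (incident? Γ e u j)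
    incidence-square u j with does (incident? Γ e u j)
    ... | true  = signValue-square (ϑ u j)
    ... | false = zeroˡ 0#

    -- Double counting of the pairs formed by an edge at `u` and its other end: counted by edges
    -- they are the incidences at `u`, counted by vertices they are the neighbours of `u`.
    gram-diagonal : ∀ u → sum (λ j → incidence u j * incidence u j) ≈ degree Γ u · 1#
    gram-diagonal u = begin
      sum (λ j → incidence u j * incidence u j)
        ≈⟨ sum-cong (λ j → trans (incidence-square u j) (sym (sum-joined-vertices u j))) ⟩
      sum (λ j → sum λ v → indicator (joins? u v j))
        ≈⟨ sum-swap (λ j v → indicator (joins? u v j)) ⟩
      sum (λ v → sum λ j → indicator (joins? u v j))
        ≈⟨ sum-cong (sum-joining-edges u) ⟩
      sum (λ v → indicator (u ~? v))
        ≈⟨ sum-indicator-count (u ~?_) (λ v → v) ⟩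
      degree Γ u · 1# ∎

    module _ (orientation : IsOrientation Γ e ϑ) where

      joins-signs : ∀ {u v j} → Joins u v j →
                    signValue (ϑ u j) * signValue (ϑ v j) ≈ - signValue (σ u v)
      joins-signs {j = j} (inj₁ (≡.refl , ≡.refl)) = trans (signValue-* (ϑ (src j) j) (ϑ (tgt j) j))
        (trans (reflexive (≡.cong signValue (orientation j))) (signValue-opposite (σ (src j) (tgt j))))
      joins-signs {j = j} (inj₂ (≡.refl , ≡.refl)) = trans (*-comm _ _)
        (trans (joins-signs {j = j} (inj₁ (≡.refl , ≡.refl)))
          (reflexive (≡.cong (λ s → - signValue s) (σ-sym (src~tgt j)))))

      -- Column `j` is supported on the two ends of edge `j`. Two distinct vertices in that support
      -- must be opposite ends, and then the orientation rule gives the sign.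
      incidence-* : ∀ {u v} → u ≢ v → ∀ j →
        incidence u j * incidence v j ≈ - signValue (σ u v) * indicator (joins? u v j)
      incidence-* {u} {v} u≢v j = by-cases (joins? u v j)
        where
        incident : ∀ {u v} → Joins u v j → Incident Γ e u j
        incident (inj₁ (p , _)) = inj₁ p
        incident (inj₂ (p , _)) = inj₂ p
        product≈0 : ¬ Joins u v j → Dec (Incident Γ e u j) → Dec (Incident Γ e v j) →
                    incidence u j * incidence v j ≈ 0#
        product≈0 _ (no ¬inc)      _              =
          trans (*-congʳ (reflexive (incidence-no ¬inc))) (zeroˡ _)
        product≈0 _ (yes _)        (no ¬inc)      =
          trans (*-congˡ (reflexive (incidence-no ¬inc))) (zeroʳ _)
        product≈0 _ (yes (inj₁ p)) (yes (inj₁ q)) = contradiction (≡.trans p (≡.sym q)) u≢v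
        product≈0 ¬joins (yes (inj₁ p)) (yes (inj₂ q)) = contradiction (inj₁ (p , q)) ¬joins
        product≈0 ¬joins (yes (inj₂ p)) (yes (inj₁ q)) = contradiction (inj₂ (p , q)) ¬joins
        product≈0 _ (yes (inj₂ p)) (yes (inj₂ q)) = contradiction (≡.trans p (≡.sym q)) u≢v
        by-cases : Dec (Joins u v j) →
          incidence u j * incidence v j ≈ - signValue (σ u v) * indicator (joins? u v j)
        by-cases (yes joins) = begin
          incidence u j * incidence v j
            ≡⟨ ≡.cong₂ _*_ (incidence-yes (incident joins))
                              (incidence-yes (incident (joins-sym joins))) ⟩
          signValue (ϑ u j) * signValue (ϑ v j)
            ≈⟨ joins-signs joins ⟩
          - signValue (σ u v)
            ≈⟨ *-identityʳ _ ⟨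
          - signValue (σ u v) * 1#
            ≡⟨ ≡.cong (- signValue (σ u v) *_) (indicator-yes (joins? u v j) joins) ⟨
          - signValue (σ u v) * indicator (joins? u v j) ∎
        by-cases (no ¬joins) = trans (product≈0 ¬joins (incident? Γ e u j) (incident? Γ e v j))
          (sym (trans (*-congˡ (reflexive (indicator-no (joins? u v j) ¬joins))) (zeroʳ _)))

      gram-off-diagonal : ∀ {u v} → u ≢ v →
        sum (λ j → incidence u j * incidence v j) ≈ - adjacency Γ u v
      gram-off-diagonal {u} {v} u≢v = begin
        sum (λ j → incidence u j * incidence v j)
          ≈⟨ sum-cong (incidence-* u≢v) ⟩
        sum (λ j → - signValue (σ u v) * indicator (joins? u v j))
          ≈⟨ sum-*ˡ (- signValue (σ u v)) (λ j → indicator (joins? u v j)) ⟩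
        - signValue (σ u v) * sum (λ j → indicator (joins? u v j))
          ≈⟨ *-congˡ (sum-joining-edges u v) ⟩
        - signValue (σ u v) * indicator (u ~? v)
          ≈⟨ -sign*indicator ⟩
        - adjacency Γ u v ∎
        where
        -sign*indicator : - signValue (σ u v) * indicator (u ~? v) ≈ - adjacency Γ u v
        -sign*indicator with does (u ~? v)
        ... | true  = *-identityʳ _
        ... | false = trans (zeroʳ _) (sym -0#≈0#)

      gram : ∀ u v → sum (λ j → incidence u j * incidence v j) ≈ laplacian Γ u v
      gram u v with u Fin.≟ v
      ... | no u≢v     = trans (gram-off-diagonal u≢v) (sym (+-identityˡ _))
      ... | yes ≡.refl = trans (gram-diagonal u) (sym (trans
              (+-congˡ (trans (-‿cong (reflexive no-loop)) -0#≈0#)) (+-identityʳ _)))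
        where
        no-loop : adjacency Γ u u ≡ 0#
        no-loop = ≡.cong (if_then signValue (σ u u) else 0#) (dec-false (u ~? u) ~-irrefl)

-- The characteristic polynomial of the extended subdivision graph.

module CharPolyS {c ℓ₁ ℓ₂} (F : EuclideanField c ℓ₁ ℓ₂)
  {n m} (Γ : SignedGraph (Fin n)) (e : Fin m ↔ Edge Γ)
  (ϑ : Fin n → Fin m → Sign) where
  open EuclideanField F using (commutativeRing; heytingField; _#_)
  open ApartnessProperties (HeytingField.heytingCommutativeRing heytingField) using (x-0≈x)
  open CommutativeRing commutativeRing hiding (zero)
  open Spectral F
  open Determinant F
  open OrderedField F
  open CharPoly F
  open Incidence F Γ e
  open RingProperties ring
  open MultProperties +-commutativeMonoid using (×-congʳ)
  open ExpProperties commutativeSemiring using (^-distrib-*; ^-homo-*)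
  open SemiringSolver commutativeSemiring using (solve; _:=_; _:*_)
  open SetoidReasoning setoid

  ↑ˡ≢↑ʳ : ∀ {a b} {i : Fin a} {j : Fin b} → i ↑ˡ b ≢ a ↑ʳ j
  ↑ˡ≢↑ʳ {a} {b} {i} {j} eq
    with ≡.trans (≡.sym (Fin.splitAt-↑ˡ a i b)) (≡.trans (≡.cong (splitAt a) eq) (Fin.splitAt-↑ʳ a b j))
  ... | ()

  module _ {a b : ℕ} (z : Carrier) where
    private
      select = if_then z else 0#

    scalar₁₁ : ∀ i j → scalar z (i ↑ˡ b) (j ↑ˡ b) ≡ scalar {a} z i j
    scalar₁₁ i j = ≡.cong select (does-⇔ (mk⇔ (Fin.↑ˡ-injective b i j) (≡.cong (_↑ˡ b)))
      ((i ↑ˡ b) Fin.≟ (j ↑ˡ b)) (i Fin.≟ j))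

    scalar₁₂ : ∀ i j → scalar z (i ↑ˡ b) (a ↑ʳ j) ≡ 0#
    scalar₁₂ i j = ≡.cong select (dec-false ((i ↑ˡ b) Fin.≟ (a ↑ʳ j)) ↑ˡ≢↑ʳ)

    scalar₂₁ : ∀ i j → scalar z (a ↑ʳ i) (j ↑ˡ b) ≡ 0#
    scalar₂₁ i j = ≡.cong select (dec-false ((a ↑ʳ i) Fin.≟ (j ↑ˡ b)) (↑ˡ≢↑ʳ ∘ ≡.sym))

    scalar₂₂ : ∀ i j → scalar z (a ↑ʳ i) (a ↑ʳ j) ≡ scalar {b} z i j
    scalar₂₂ i j = ≡.cong select (does-⇔ (mk⇔ (Fin.↑ʳ-injective a i j) (≡.cong (a ↑ʳ_)))
      ((a ↑ʳ i) Fin.≟ (a ↑ʳ j)) (i Fin.≟ j))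

  module _ (p k : ℕ) where

    a b : ℕ
    a = n ℕ.* suc p
    b = m ℕ.* suc k

    A : Rows (a ℕ.+ b) (a ℕ.+ b)
    A = adjacencyS Γ e ϑ p k

    -- The matrix `C`: the copies of a vertex or edge occupy consecutive indices, and `quotient`
    -- forgets the copy number.
    incidenceS : Rows a b
    incidenceS i j = incidence ϑ (quotient (suc p) i) (quotient (suc k) j)

    incidenceSᵀ : Rows b a
    incidenceSᵀ j i = incidenceS i j

    relabel : Fin a ⊎ Fin b → SVertex Γ e p k
    relabel = Sum.map (remQuot (suc p)) (remQuot (suc k))

    relabel-left : ∀ i → Inverse.to (SVertices Γ e p k) (i ↑ˡ b) ≡ inj₁ (remQuot (suc p) i)
    relabel-left i = ≡.cong relabel (Fin.splitAt-↑ˡ a i b)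

    relabel-right : ∀ j → Inverse.to (SVertices Γ e p k) (a ↑ʳ j) ≡ inj₂ (remQuot (suc k) j)
    relabel-right j = ≡.cong relabel (Fin.splitAt-↑ʳ a b j)

    charMatrixS-block : ∀ x →
      charMatrix A x ≋ block (scalar x) (⊖ incidenceS) (⊖ incidenceSᵀ) (scalar x)
    charMatrixS-block x = block-intro
      (λ i j → trans (entry (scalar₁₁ x i j) (relabel-left i) (relabel-left j)) (x-0≈x _))
      (λ i j → trans (entry (scalar₁₂ x i j) (relabel-left i) (relabel-right j)) (+-identityˡ _))
      (λ i j → trans (entry (scalar₂₁ x i j) (relabel-right i) (relabel-left j)) (+-identityˡ _))
      (λ i j → trans (entry (scalar₂₂ {a} x i j) (relabel-right i) (relabel-right j)) (x-0≈x _))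
      where
      entry : ∀ {i j y u v} → scalar x i j ≡ y →
              Inverse.to (SVertices Γ e p k) i ≡ u → Inverse.to (SVertices Γ e p k) j ≡ v →
              charMatrix A x i j ≈ y - adjacency (SGraph Γ e ϑ p k) u v
      entry r s t = reflexive (≡.cong₂ _-_ r (≡.cong₂ (adjacency (SGraph Γ e ϑ p k)) s t))

    module _ (orientation : IsOrientation Γ e ϑ) where

      gramS : Rows a a
      gramS i i′ = suc k · laplacian Γ (quotient (suc p) i) (quotient (suc p) i′)

      -- The signs introduced by `charMatrix` cancel in the product. Summation runs over the edge
      -- copies and turns them into the factor `suc k`, whereas the vertex copies remain as repeated
      -- rows and columns.
      incidenceS-gram : (⊖ incidenceS) ⊗ (⊖ incidenceSᵀ) ≋ gramS
      incidenceS-gram i i′ = begin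
        sum (λ j → - incidenceS i j * - incidenceS i′ j)
          ≈⟨ sum-cong (λ j → neg*neg (incidenceS i j) (incidenceS i′ j)) ⟩
        sum (λ j → incidenceS i j * incidenceS i′ j)
          ≈⟨ sum-quotient (suc k) (λ j → incidence ϑ u j * incidence ϑ v j) ⟩
        suc k · sum (λ j → incidence ϑ u j * incidence ϑ v j)
          ≈⟨ ×-congʳ (suc k) (gram ϑ orientation u v) ⟩
        gramS i i′ ∎
        where
        u = quotient (suc p) i
        v = quotient (suc p) i′
        neg*neg : ∀ y z → - y * - z ≈ y * z
        neg*neg y z = trans (sym (-‿distribˡ-* y (- z)))
          (trans (-‿cong (sym (-‿distribʳ-* y z))) (-‿involutive _))

      charPolyS-gram : ∀ x → x ^ a * charPoly A x ≈ charPoly gramS (x * x) * x ^ b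
      charPolyS-gram x = begin
        x ^ a * charPoly A x
          ≈⟨ *-congˡ (det-cong (charMatrixS-block x)) ⟩
        x ^ a * det (block (scalar x) (⊖ incidenceS) (⊖ incidenceSᵀ) (scalar x))
          ≈⟨ sylvester-upper x x (⊖ incidenceS) (⊖ incidenceSᵀ) ⟩
        charPoly ((⊖ incidenceS) ⊗ (⊖ incidenceSᵀ)) (x * x) * x ^ b
          ≈⟨ *-congʳ (charPoly-cong incidenceS-gram refl) ⟩
        charPoly gramS (x * x) * x ^ b ∎

      -- Equal to `a + b - 2n` when `p` is positive: the eigenvalues left after pairing off `2n` of
      -- them with those of the Laplacian.
      nullity : ℕ
      nullity = (p ∸ 1) ℕ.* n ℕ.+ suc k ℕ.* m

      charPolyL : Carrier → Carrier
      charPolyL = charPoly ((suc p ℕ.* suc k) ·ᴹ laplacian Γ)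

      -- The extra factor `x ^ (n + n)` is the `(x * x) ^ n` that `duplication` requires in order to
      -- trade `gramS` for the Laplacian. The result compares the exponents `2n + a` and `b + 2a`,
      -- whose difference is `nullity`.
      charPolyS-nonzero : 1 ℕ.≤ p → ∀ {x} → x # 0# →
        charPoly A x ≈ x ^ nullity * charPolyL (x * x)
      charPolyS-nonzero 1≤p {x} x#0 =
        *-cancelˡ-#0 (^-#0 ((n ℕ.+ n) ℕ.+ a) x#0) (begin
          x ^ ((n ℕ.+ n) ℕ.+ a) * charPoly A x
            ≈⟨ trans (*-congʳ (^-homo-* x (n ℕ.+ n) a)) (*-assoc _ _ _) ⟩
          x ^ (n ℕ.+ n) * (x ^ a * charPoly A x)
            ≈⟨ *-congˡ (charPolyS-gram x) ⟩
          x ^ (n ℕ.+ n) * (charPoly gramS (x * x) * x ^ b)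
            ≈⟨ solve 3 (λ r s t → r :* (s :* t) := t :* (r :* s)) refl
                 (x ^ (n ℕ.+ n)) (charPoly gramS (x * x)) (x ^ b) ⟩
          x ^ b * (x ^ (n ℕ.+ n) * charPoly gramS (x * x))
            ≈⟨ *-congˡ (*-congʳ (square^ n)) ⟨
          x ^ b * ((x * x) ^ n * charPoly gramS (x * x))
            ≈⟨ *-congˡ (duplication (suc p) (suc k) (laplacian Γ) (x * x)) ⟨
          x ^ b * ((x * x) ^ a * charPolyL (x * x))
            ≈⟨ *-congˡ (*-congʳ (square^ a)) ⟩
          x ^ b * (x ^ (a ℕ.+ a) * charPolyL (x * x))
            ≈⟨ trans (*-congʳ (^-homo-* x b (a ℕ.+ a))) (*-assoc _ _ _) ⟨
          x ^ (b ℕ.+ (a ℕ.+ a)) * charPolyL (x * x)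
            ≡⟨ ≡.cong (λ r → x ^ r * charPolyL (x * x)) (exponents 1≤p) ⟩
          x ^ (((n ℕ.+ n) ℕ.+ a) ℕ.+ nullity) * charPolyL (x * x)
            ≈⟨ trans (*-congʳ (^-homo-* x ((n ℕ.+ n) ℕ.+ a) nullity)) (*-assoc _ _ _) ⟩
          x ^ ((n ℕ.+ n) ℕ.+ a) * (x ^ nullity * charPolyL (x * x)) ∎)
        where
        square^ : ∀ r → (x * x) ^ r ≈ x ^ (r ℕ.+ r)
        square^ r = trans (^-distrib-* x x r) (sym (^-homo-* x r r))
        exponents : 1 ℕ.≤ p → b ℕ.+ (a ℕ.+ a) ≡ ((n ℕ.+ n) ℕ.+ a) ℕ.+ nullity
        -- With `p` equal to `suc q`, `suc p` is `2 + q` and `p ∸ 1` is `q`, so no truncated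
        -- subtraction reaches the solver.
        exponents (ℕ.s≤s {n = q} _) = ℕ-solve 4 (λ n m q k →
          m ⊙ (one ⊞ k) ⊞ (n ⊙ (con 2 ⊞ q) ⊞ n ⊙ (con 2 ⊞ q)) ≔
          ((n ⊞ n) ⊞ n ⊙ (con 2 ⊞ q)) ⊞ (q ⊙ n ⊞ (one ⊞ k) ⊙ m)) ≡.refl n m q k
          where
          open +-*-Solver using (con) renaming (solve to ℕ-solve; _:+_ to _⊞_; _:*_ to _⊙_; _:=_ to _≔_)
          one = con 1

  module _ (θ : Fin n → Sign)
    (switches : ∀ {u v} → SignedGraph._~_ Γ u v → SignedGraph.σ Γ u v ≡ θ u Sign.* θ v) where
    open SignedGraph Γ

    switched-adjacency : ∀ u v →
      signValue (θ u) * adjacency Γ u v ≈ signValue (θ v) * indicator (v ~? u)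
    switched-adjacency u v = by-cases (u ~? v)
      where
      by-cases : Dec (u ~ v) →
        signValue (θ u) * adjacency Γ u v ≈ signValue (θ v) * indicator (v ~? u)
      by-cases (yes u~v) = begin
        signValue (θ u) * adjacency Γ u v
          ≡⟨ ≡.cong (λ d → signValue (θ u) * (if d then signValue (σ u v) else 0#))
               (dec-true (u ~? v) u~v) ⟩
        signValue (θ u) * signValue (σ u v)
          ≈⟨ *-congˡ (trans (reflexive (≡.cong signValue (switches u~v)))
                            (sym (signValue-* (θ u) (θ v)))) ⟩
        signValue (θ u) * (signValue (θ u) * signValue (θ v))
          ≈⟨ trans (sym (*-assoc _ _ _)) (trans (*-congʳ (signValue-square (θ u))) (*-comm _ _)) ⟩
        signValue (θ v) * 1#
          ≡⟨ ≡.cong (signValue (θ v) *_) (indicator-yes (v ~? u) (~-sym u~v)) ⟨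
        signValue (θ v) * indicator (v ~? u) ∎
      by-cases (no u≁v) = begin
        signValue (θ u) * adjacency Γ u v
          ≡⟨ ≡.cong (λ d → signValue (θ u) * (if d then signValue (σ u v) else 0#))
               (dec-false (u ~? v) u≁v) ⟩
        signValue (θ u) * 0#
          ≈⟨ trans (zeroʳ _) (sym (zeroʳ _)) ⟩
        signValue (θ v) * 0#
          ≡⟨ ≡.cong (signValue (θ v) *_) (indicator-no (v ~? u) (u≁v ∘ ~-sym)) ⟨
        signValue (θ v) * indicator (v ~? u) ∎

    -- On an edge, `θ u` times `σ u v` is `θ v`, so the adjacency part of column `v` sums to `θ v`
    -- times the degree of `v`, which is exactly the diagonal contribution.
    switched-laplacian : ∀ v → sum (λ u → signValue (θ u) * laplacian Γ u v) ≈ 0#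
    switched-laplacian v = begin
      sum (λ u → signValue (θ u) * laplacian Γ u v)
        ≈⟨ sum-cong term ⟩
      sum (λ u → s u * d u * scalar 1# u v + - s v * indicator (v ~? u))
        ≈⟨ sum-+ (λ u → s u * d u * scalar 1# u v) (λ u → - s v * indicator (v ~? u)) ⟩
      sum (λ u → s u * d u * scalar 1# u v) + sum (λ u → - s v * indicator (v ~? u))
        ≈⟨ +-cong (trans (sum-scalarʳ 1# v λ u → s u * d u) (*-identityʳ _))
                  (trans (sum-*ˡ (- s v) (λ u → indicator (v ~? u)))
                         (*-congˡ (sum-indicator-count (v ~?_) (λ u → u)))) ⟩
      s v * d v + - s v * d v
        ≈⟨ trans (+-congˡ (sym (-‿distribˡ-* _ _))) (-‿inverseʳ _) ⟩
      0# ∎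
      where
      s d : Fin n → Carrier
      s u = signValue (θ u)
      d u = degree Γ u · 1#
      diagonal : ∀ u → (if does (u Fin.≟ v) then d u else 0#) ≈ d u * scalar 1# u v
      diagonal u with does (u Fin.≟ v)
      ... | true  = sym (*-identityʳ _)
      ... | false = sym (zeroʳ _)
      term : ∀ u → s u * laplacian Γ u v ≈ s u * d u * scalar 1# u v + - s v * indicator (v ~? u)
      term u = trans (distribˡ _ _ _) (+-cong
        (trans (*-congˡ (diagonal u)) (sym (*-assoc _ _ _)))
        (trans (sym (-‿distribʳ-* _ _)) (trans (-‿cong (switched-adjacency u v)) (-‿distribˡ-* _ _))))

-- The two spectra, with the value at zero.

module Spectra {c ℓ₁ ℓ₂} (F : EuclideanField c ℓ₁ ℓ₂) where
  open EuclideanField F using (commutativeRing; heytingField; _≤_; _#_; #-irrefl)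
  open ApartnessProperties (HeytingField.heytingCommutativeRing heytingField)
    using (1#0; x#0y#0→xy#0)
  open CommutativeRing commutativeRing hiding (zero)
  open Spectral F
  open Determinant F
  open OrderedField F
  open CharPoly F
  open RingProperties ring
  open MultProperties +-commutativeMonoid using (×-congʳ)
  open ExpProperties commutativeSemiring using (^-homo-*)
  open SetoidReasoning setoid

  scalar-zero : ∀ {n} {x} → x ≈ 0# → ∀ (i j : Fin n) → scalar x i j ≈ 0#
  scalar-zero x≈0 i j with does (i Fin.≟ j)
  ... | true  = x≈0
  ... | false = refl

  charPolyS-zero : ∀ {n m} (Γ : SignedGraph (Fin (suc n))) (e : Fin m ↔ Edge Γ) ϑ {p} k → 1 ℕ.≤ p →
    ∀ {x} → x ≈ 0# → charPoly (adjacencyS Γ e ϑ p k) x ≈ 0#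
  charPolyS-zero Γ e ϑ {suc p} k _ {x} x≈0 =
    -- Indices 0 and 1 are the first two copies of vertex `zero`. Their rows in the characteristic
    -- matrix agree once `x ≈ 0#` removes the diagonal.
    det-first-two-equal (charMatrix (adjacencyS Γ e ϑ (suc p) k) x) λ j → +-cong
      (trans (scalar-zero x≈0 (suc zero) j) (sym (scalar-zero x≈0 zero j)))
      (-‿cong (reflexive (copies (Inverse.to (SVertices Γ e (suc p) k) j))))
    where
    copies : ∀ y → adjacency (SGraph Γ e ϑ (suc p) k) (inj₁ (zero , suc zero)) y ≡
                   adjacency (SGraph Γ e ϑ (suc p) k) (inj₁ (zero , zero)) y
    copies (inj₁ _) = ≡.refl
    copies (inj₂ _) = ≡.refl

  laplacian-singular : ∀ {n m} (Γ : SignedGraph (Fin (suc n))) (e : Fin m ↔ Edge Γ)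
    (ϑ : Fin (suc n) → Fin m → Sign) →
    Connected Γ → Balanced Γ → charPoly (laplacian Γ) 0# ≈ 0#
  laplacian-singular {n} Γ e ϑ connected balanced =
    -- A sign value is its own inverse, so `w zero` also serves as its inverse.
    det-singular (charMatrix (laplacian Γ) 0#) w (signValue-square (θ zero)) λ v → begin
      sum (λ u → w u * charMatrix (laplacian Γ) 0# u v)
        ≈⟨ sum-cong (λ u → negate u v) ⟩
      sum (λ u → - 1# * (w u * laplacian Γ u v))
        ≈⟨ sum-*ˡ (- 1#) (λ u → w u * laplacian Γ u v) ⟩
      - 1# * sum (λ u → w u * laplacian Γ u v)
        ≈⟨ *-congˡ (switched-laplacian θ switches v) ⟩
      - 1# * 0#
        ≈⟨ zeroʳ _ ⟩
      0# ∎
    where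
    open Incidence F Γ e using (signValue-square)
    open CharPolyS F Γ e ϑ using (switched-laplacian)
    switching = Walks.switching Fin._≟_ Γ balanced connected
    θ = proj₁ switching
    switches : ∀ {u v} → SignedGraph._~_ Γ u v → SignedGraph.σ Γ u v ≡ θ u Sign.* θ v
    switches = proj₂ switching
    w : Vector Carrier (suc n)
    w u = signValue (θ u)
    negate : ∀ u v → w u * charMatrix (laplacian Γ) 0# u v ≈ - 1# * (w u * laplacian Γ u v)
    negate u v = begin
      w u * (scalar 0# u v - laplacian Γ u v)
        ≈⟨ *-congˡ (trans (+-congʳ (scalar-zero refl u v)) (+-identityˡ _)) ⟩
      w u * - laplacian Γ u v
        ≈⟨ trans (sym (-‿distribʳ-* _ _)) (sym (-1*x≈-x _)) ⟩
      - 1# * (w u * laplacian Γ u v) ∎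

  -- Used contrapositively: an unbalanced graph has `m` positive, so the power of `x` in its
  -- characteristic polynomial vanishes at 0.
  edgeless⇒balanced : ∀ {n} (Γ : SignedGraph (Fin n)) → (Fin 0 ↔ Edge Γ) → Balanced Γ
  edgeless⇒balanced Γ e ε         (() , _)
  edgeless⇒balanced Γ e (u~v ◅ _) _ with Incidence.joining-edge F Γ e u~v
  ... | () , _

  linearProduct-#0 : ∀ {n} (μ : Fin n → Carrier) → (∀ i → μ i # 0#) →
                     linearProduct (tabulate μ) 0# # 0#
  linearProduct-#0 {zero}  μ μ#0 = 1#0
  linearProduct-#0 {suc n} μ μ#0 =
    x#0y#0→xy#0 (neg-#0 (μ#0 zero)) (linearProduct-#0 (μ ∘ suc) (μ#0 ∘ suc))

  -- Were the least value apart from `0#`, monotonicity would make all of them so, and then their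
  -- product too. Tightness turns this refutation into an equality.
  least-zero : ∀ {n} (μ : Fin (suc n) → Carrier) → (∀ i j → i Fin.≤ j → μ j ≤ μ i) → (∀ i → 0# ≤ μ i) →
    linearProduct (tabulate μ) 0# ≈ 0# → μ (Fin.fromℕ n) ≈ 0#
  least-zero {n} μ antitone nonneg product≈0 = ¬#⇒≈ λ last#0 → #-irrefl product≈0
    (linearProduct-#0 μ λ i →
      #0-upward (nonneg _) (antitone i (Fin.fromℕ n) (Fin.≤fromℕ i)) last#0)

  take-tabulate : ∀ {n} (μ : Fin (suc n) → Carrier) →
                  take n (tabulate μ) ++ (μ (Fin.fromℕ n) ∷ []) ≡ tabulate μ
  take-tabulate {zero}  μ = ≡.refl
  take-tabulate {suc n} μ = ≡.cong (μ zero ∷_) (take-tabulate (μ ∘ suc))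

  pos-power-zero : ∀ {r} → 1 ℕ.≤ r → ∀ {x} → x ≈ 0# → x ^ r ≈ 0#
  pos-power-zero (ℕ.s≤s _) x≈0 = trans (*-congʳ x≈0) (zeroˡ _)

  module _ {n m} (Γ : SignedGraph (Fin (suc n))) (e : Fin m ↔ Edge Γ)
    (ϑ : Fin (suc n) → Fin m → Sign) (orientation : IsOrientation Γ e ϑ)
    (μ : Fin (suc n) → Carrier) (spectrum : IsSpectrum (laplacian Γ) (tabulate μ))
    (nonneg : ∀ i → 0# ≤ μ i) (p k : ℕ) (1≤p : 1 ℕ.≤ p) where

    private
      N a : ℕ
      N = (p ∸ 1) ℕ.* suc n ℕ.+ suc k ℕ.* m
      a = suc p ℕ.* suc k
      R : Carrier → Carrier
      R = linearProduct (List.map (a ·_) (tabulate μ))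

    -- If the two sides were apart, `x` could not be apart from `0#`, hence would equal it, and then
    -- both sides are zero. The vanishing of the right side is left as the hypothesis `at-zero`
    -- because its reason differs between the balanced and the unbalanced case.
    charPolyS : ∀ x → (x ≈ 0# → x ^ N * R (x * x) ≈ 0#) →
                charPoly (adjacencyS Γ e ϑ p k) x ≈ x ^ N * R (x * x)
    charPolyS x at-zero = ¬#⇒≈ λ apart →
      let x≈0 = ¬#⇒≈ λ x#0 → #-irrefl (away-from-zero x#0) apart in
      #-irrefl (trans (charPolyS-zero Γ e ϑ k 1≤p x≈0) (sym (at-zero x≈0))) apart
      where
      away-from-zero : x # 0# → charPoly (adjacencyS Γ e ϑ p k) x ≈ x ^ N * R (x * x)
      away-from-zero x#0 = trans
        (CharPolyS.charPolyS-nonzero F Γ e ϑ p k orientation 1≤p x#0)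
        -- `a` computes to the successor of `k + p * suc k`, the form in which `charPoly-multiple`
        -- takes its multiplier.
        (*-congˡ (charPoly-multiple (k ℕ.+ p ℕ.* suc k) (laplacian Γ) μ spectrum (x * x)))

    spectrum-unbalanced : ¬ Balanced Γ →
      IsSpectrum (adjacencyS Γ e ϑ p k) (replicate N 0# ++ ±√ a (tabulate μ))
    spectrum-unbalanced unbalanced x = begin
      charPoly (adjacencyS Γ e ϑ p k) x
        ≈⟨ charPolyS x (λ x≈0 → trans (*-congʳ (pos-power-zero N-pos x≈0)) (zeroˡ _)) ⟩
      x ^ N * R (x * x)
        ≈⟨ *-cong (linearProduct-zeros N x) (linearProduct-±√ a (tabulate⁺ nonneg) x) ⟨
      linearProduct (replicate N 0#) x * linearProduct (±√ a (tabulate μ)) x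
        ≈⟨ linearProduct-++ (replicate N 0#) (±√ a (tabulate μ)) x ⟨
      linearProduct (replicate N 0# ++ ±√ a (tabulate μ)) x ∎
      where
      m-pos : 1 ℕ.≤ m
      m-pos = ℕ.n≢0⇒n>0 λ { ≡.refl → unbalanced (edgeless⇒balanced Γ e) }
      N-pos : 1 ℕ.≤ N
      N-pos = ℕ.≤-trans (ℕ.*-mono-≤ (ℕ.s≤s (ℕ.z≤n {k})) m-pos) (ℕ.m≤n+m _ ((p ∸ 1) ℕ.* suc n))

    spectrum-balanced : μ (Fin.fromℕ n) ≈ 0# →
      IsSpectrum (adjacencyS Γ e ϑ p k) (replicate (N ℕ.+ 2) 0# ++ ±√ a (take n (tabulate μ)))
    spectrum-balanced last≈0 x = begin
      charPoly (adjacencyS Γ e ϑ p k) x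
        -- `N` is zero when `p` is 1 and there are no edges, so the vanishing at 0 is drawn from the
        -- factor `x * x` of the zero eigenvalue instead of from `x ^ N`.
        ≈⟨ charPolyS x (λ x≈0 → trans (*-congˡ (trans (R-split (x * x))
             (trans (*-congˡ (trans (*-congʳ x≈0) (zeroˡ x))) (zeroʳ _)))) (zeroʳ _)) ⟩
      x ^ N * R (x * x)
        ≈⟨ *-congˡ (trans (R-split (x * x)) (*-comm _ _)) ⟩
      x ^ N * (x * x * R′ (x * x))
        ≈⟨ *-assoc _ _ _ ⟨
      x ^ N * (x * x) * R′ (x * x)
        ≈⟨ *-congʳ (trans (^-homo-* x N 2) (*-congˡ (*-congˡ (*-identityʳ x)))) ⟨
      x ^ (N ℕ.+ 2) * R′ (x * x)
        ≈⟨ *-cong (linearProduct-zeros (N ℕ.+ 2) x)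
                  (linearProduct-±√ a (take⁺ n (tabulate⁺ nonneg)) x) ⟨
      linearProduct (replicate (N ℕ.+ 2) 0#) x * linearProduct (±√ a (take n (tabulate μ))) x
        ≈⟨ linearProduct-++ (replicate (N ℕ.+ 2) 0#) (±√ a (take n (tabulate μ))) x ⟨
      linearProduct (replicate (N ℕ.+ 2) 0# ++ ±√ a (take n (tabulate μ))) x ∎
      where
      R′ : Carrier → Carrier
      R′ = linearProduct (List.map (a ·_) (take n (tabulate μ)))
      last = μ (Fin.fromℕ n)
      a·last≈0 : a · last ≈ 0#
      a·last≈0 = trans (×-congʳ a last≈0) (trans (sym (sum-const a 0#)) (sum-zero {a} λ _ → refl))
      R-split : ∀ y → R y ≈ R′ y * y
      R-split y = begin
        R y
          ≡⟨ ≡.cong (λ l → linearProduct (List.map (a ·_) l) y) (take-tabulate μ) ⟨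
        linearProduct (List.map (a ·_) (take n (tabulate μ) ++ (last ∷ []))) y
          ≡⟨ ≡.cong (λ l → linearProduct l y) (List.map-++ (a ·_) (take n (tabulate μ)) (last ∷ [])) ⟩
        linearProduct (List.map (a ·_) (take n (tabulate μ)) ++ (a · last ∷ [])) y
          ≈⟨ linearProduct-++ (List.map (a ·_) (take n (tabulate μ))) (a · last ∷ []) y ⟩
        R′ y * ((y - a · last) * 1#)
          ≈⟨ *-congˡ (trans (*-identityʳ _)
               (trans (+-congˡ (trans (-‿cong a·last≈0) -0#≈0#)) (+-identityʳ y))) ⟩
        R′ y * y ∎

theorem4p4 : ∀ {c ℓ₁ ℓ₂} (F : EuclideanField c ℓ₁ ℓ₂) →
    let open EuclideanField F in
    let open Spectral F in
    ∀ {n m} (Γ : SignedGraph (Fin n)) (e : Fin m ↔ Edge Γ) →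
    Connected Γ →
    (ϑ : Fin n → Fin m → Sign) → IsOrientation Γ e ϑ →
    (μ : Fin n → Carrier) → IsSpectrum (laplacian Γ) (tabulate μ) →
    (∀ i j → i Fin.≤ j → μ j ≤ μ i) → (∀ i → 0# ≤ μ i) →
    (p k : ℕ) → 1 ℕ.≤ p → k ≡ p ⊎ k ≡ p ∸ 1 →
    (Balanced Γ →
    IsSpectrum (adjacencyS Γ e ϑ p k)
    (replicate ((p ∸ 1) ℕ.* n ℕ.+ suc k ℕ.* m ℕ.+ 2) 0#
    ++ ±√ (suc p ℕ.* suc k) (take (n ∸ 1) (tabulate μ))))
    ×
    (¬ Balanced Γ →
    IsSpectrum (adjacencyS Γ e ϑ p k)
    (replicate ((p ∸ 1) ℕ.* n ℕ.+ suc k ℕ.* m) 0#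
    ++ ±√ (suc p ℕ.* suc k) (tabulate μ)))
-- `Connected` supplies a vertex, which the empty graph cannot have.
theorem4p4 F {zero}  Γ e (() , _)
theorem4p4 F {suc n} Γ e connected ϑ orientation μ spectrum antitone nonneg p k 1≤p _ =
  -- At `0#` the Laplacian spectrum gives the product of the negated eigenvalues, and singularity
  -- makes it zero.
  (λ balanced → spectrum-balanced Γ e ϑ orientation μ spectrum nonneg p k 1≤p
    (least-zero μ antitone nonneg (trans (sym (spectrum 0#))
      (laplacian-singular Γ e ϑ connected balanced)))) ,
  spectrum-unbalanced Γ e ϑ orientation μ spectrum nonneg p k 1≤p
  where
  open Spectra F
  open EuclideanField F using (trans; sym; 0#)
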